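{- The sets $\mathcal{Y}_2=\{S_\infty,L_2\}$, $\mathcal{N}_{2,1}=\{L_2\}$, $\mathcal{N}_{2,2}=\{S_3,C_2\}$ and $\mathcal{N}_{2,3}=\{S_3,Z_2\}$ form a characterizing collection of winners and losers for size $2$ teams; that is, $\mathcal{Y}_2$ is a winning team, each $\mathcal{N}_{2,i}$ ($1\le i\le3$) is a losing team, and for every team $\mathcal{F}$ of size $2$, either $\mathcal{F}\preceq\mathcal{Y}_2$ or $\mathcal{N}_{2,i}\preceq\mathcal{F}$ for some $i\in\{1,2,3\}$. (Consequently a team of size $2$ is a winner if and only if it is simpler than $\mathcal{Y}_2$.)
   Context: Board and polyominoes. The cells are the translates of the unit square $[0,1]\times[0,1]$ by vectors of $\mathbf{Z}^2$; identify a cell with the vector in $\mathbf{Z}^2$. Two cells are adjacent if they share an edge. A polyomino is a nonempty (finite or infinite) set of cells that is connected through adjacent cells, considered up to congruence (translations, rotations, reflections of the board). Game. Two players, maker (moving first) and breaker, alternately mark previously unmarked cells of the infinite board: in each turn the maker marks 1 cell and the breaker marks 2 cells. For a set $\mathcal{S}$ of finite polyominoes, the maker wins if after finitely many moves he has marked all the cells of a set congruent to some element of $\mathcal{S}$; the breaker wins if she prevents this. $\mathcal{S}$ is a winner (winning) if the maker has a winning strategy. Ancestors. $P\sqsubseteq Q$ ($P$ is an ancestor of $Q$) means that some congruent copy of $P$ is a subset of $Q$. A team is a set of polyominoes no element of which is an ancestor of another element; its size is its number of elements. Unbounded sets. A set of polyominoes is unbounded if it contains an infinite polyomino. If $\mathcal{T}$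 is unbounded and $F_T$ is a finite ancestor of $T$ for each $T\in\mathcal{T}$, then $\{F_T\mid T\in\mathcal{T}\}$ is a bounded restriction of $\mathcal{T}$. An unbounded set is a winner if each of its bounded restrictions is a winner. A set that is not a winner is a loser (losing). Simpler. $\mathcal{S}\preceq\mathcal{T}$ ($\mathcal{S}$ is simpler than $\mathcal{T}$) means that for all $Q\in\mathcal{T}$ there is $P\in\mathcal{S}$ with $P\sqsubseteq Q$. Particular polyominoes (up to congruence): $S_n=\{(0,0),\dots,(n-1,0)\}$; $S_\infty=\{(i,0)\mid i\ge0\}$ (only one end is infinite); $L_2=\{(0,0),(1,0),(0,1)\}$; $C_2=\{(0,0),(1,0),(0,1),(1,1)\}$; $Z_2=\{(0,0),(1,0),(0,1),(1,-1)\}$.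
   Formalization: The claim for every team of size 2, and the closing "if and only if", exclude the team consisting of the two-way infinite line and L_2: it is a winner but is not simpler than Y_2, and no N_{2,i} is simpler than it, so the claim as stated fails for it. -}

module Defs where

open import Data.Bool.Base using (Bool; true; false; if_then_else_)
open import Data.Fin.Base using (Fin)
open import Data.Fin.Patterns using (0F; 1F; 2F; 3F)
open import Data.Integer.Base as ℤ using (ℤ; +_; -[1+_]; -_; ∣_∣; 0ℤ; 1ℤ; -1ℤ)
import Data.Integer.Properties as ℤ
open import Data.List.Base using (List; []; _∷_; map; concatMap)
import Data.List.Membership.Propositional as List
import Data.List.Relation.Unary.All as All
open import Data.List.Relation.Unary.All using (All; []; _∷_)
open import Data.List.Relation.Unary.Any using (here; there)
open import Data.Nat.Base as ℕ using (ℕ; zero; suc; NonZero; z<s)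
import Data.Nat.Properties as ℕ
open import Data.Product.Base using (∃; ∃-syntax; Σ-syntax; _×_; _,_; proj₁; proj₂)
open import Data.Sum.Base using (_⊎_)
open import Data.Vec.Functional as Vector using (Vector)
open import Function.Bundles using (_⇔_)
open import Level using (Level; 0ℓ; _⊔_) renaming (suc to lsuc)
open import Relation.Binary.Construct.Closure.ReflexiveTransitive
  using (Star; ε; _◅_; _◅◅_; reverse)
open import Relation.Binary.PropositionalEquality
  using (_≡_; _≢_; refl; sym; trans; cong; cong₂)
open import Relation.Nullary.Negation using (¬_)
open import Relation.Unary using (Pred; _∈_; _∉_; _⊆_; Satisfiable)

------------------------------------------------------------------------
-- Board

-- The unit square with lower left corner (x , y).
Cell : Set
Cell = ℤ × ℤ

-- Two unit squares of the board share an edge exactly when their corners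
-- differ by one unit in exactly one coordinate.
Adjacent : Cell → Cell → Set
Adjacent (x₁ , y₁) (x₂ , y₂) = ∣ x₁ ℤ.- x₂ ∣ ℕ.+ ∣ y₁ ℤ.- y₂ ∣ ≡ 1

-- Every congruence of the board acts on (the corners of) cells as an
-- optional reflection, followed by some quarter turns, followed by an
-- integer translation.
record Congruence : Set where
  field
    reflected    : Bool
    quarterTurns : Fin 4
    translation  : Cell

reflect : Cell → Cell
reflect (x , y) = x , - y

turn : Fin 4 → Cell → Cell
turn 0F (x , y) = x , y
turn 1F (x , y) = - y , x
turn 2F (x , y) = - x , - y
turn 3F (x , y) = y , - x

translate : Cell → Cell → Cell
translate (a , b) (x , y) = a ℤ.+ x , b ℤ.+ y

infixr 9 _·_

_·_ : Congruence → Cell → Cell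
g · c = translate translation (turn quarterTurns (if reflected then reflect c else c))
  where open Congruence g

------------------------------------------------------------------------
-- Polyominoes

Step : Pred Cell 0ℓ → Cell → Cell → Set
Step A p q = p ∈ A × q ∈ A × Adjacent p q

record Polyomino : Set₁ where
  field
    cells     : Pred Cell 0ℓ
    nonempty  : Satisfiable cells
    connected : ∀ {p q} → p ∈ cells → q ∈ cells → Star (Step cells) p q

open Polyomino public

Finite : Polyomino → Set
Finite P = ∃[ xs ] cells P ⊆ (List._∈ xs)

Infinite : Polyomino → Set
Infinite P = ¬ Finite P

infix 4 _≅_ _⊑_ _⪯_

_≅_ : Polyomino → Polyomino → Set
P ≅ Q = ∃[ g ] ∀ c → c ∈ cells P ⇔ g · c ∈ cells Q

_⊑_ : Polyomino → Polyomino → Set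
P ⊑ Q = ∃[ g ] ∀ {c} → c ∈ cells P → g · c ∈ cells Q

------------------------------------------------------------------------
-- Sets of polyominoes

-- A set of polyominoes (up to congruence) is given as the family of its
-- elements, indexed by an arbitrary type.

private
  variable
    i j : Level
    I : Set i
    J : Set j

_⪯_ : (I → Polyomino) → (J → Polyomino) → Set _
𝒮 ⪯ 𝒯 = ∀ j → ∃[ i ] 𝒮 i ⊑ 𝒯 j

-- As congruent polyominoes are ancestors of each other, a family that is
-- a team lists its elements without repetition; hence the teams of size n
-- are the teams 𝒯 : Vector Polyomino n.
Team : (I → Polyomino) → Set _
Team 𝒯 = ∀ {i j} → i ≢ j → ¬ 𝒯 i ⊑ 𝒯 j

Bounded : (I → Polyomino) → Set _
Bounded 𝒮 = ∀ i → Finite (𝒮 i)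

Unbounded : (I → Polyomino) → Set _
Unbounded 𝒮 = ∃[ i ] Infinite (𝒮 i)

BoundedRestriction : (I → Polyomino) → (I → Polyomino) → Set _
BoundedRestriction ℱ 𝒯 = ∀ i → Finite (ℱ i) × ℱ i ⊑ 𝒯 i

------------------------------------------------------------------------
-- The game

-- A cell of the maker together with the two cells of the breaker's reply.
Round : Set
Round = Cell × Cell × Cell

-- Most recent round first.
History : Set
History = List Round

makerCells : History → List Cell
makerCells = map proj₁

markedCells : History → List Cell
markedCells = concatMap λ (m , b₁ , b₂) → m ∷ b₁ ∷ b₂ ∷ []

-- Strategies only ever produce legal moves, and may depend on the whole
-- history.  Since the board is infinite, a legal move always exists.
MakerStrategy : Set
MakerStrategy = ∀ h → ∃[ m ] m List.∉ markedCells h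

BreakerStrategy : Set
BreakerStrategy = ∀ h m → m List.∉ markedCells h →
  Σ[ (b₁ , b₂) ∈ Cell × Cell ]
    b₁ List.∉ m ∷ markedCells h × b₂ List.∉ b₁ ∷ m ∷ markedCells h

play : MakerStrategy → BreakerStrategy → ℕ → History
play σ τ zero    = []
play σ τ (suc n) =
  let h             = play σ τ n
      m , legal     = σ h
      (b₁ , b₂) , _ = τ h m legal
  in (m , b₁ , b₂) ∷ h

Achieved : (I → Polyomino) → History → Set _
Achieved 𝒮 h = ∃[ i ] ∃[ g ] ∀ {c} → c ∈ cells (𝒮 i) → g · c List.∈ makerCells h

-- Letting the breaker complete the round in which the maker achieves his
-- goal does not affect the outcome.
MakerWins : (I → Polyomino) → Set _
MakerWins 𝒮 = Σ[ σ ∈ MakerStrategy ] ∀ τ → ∃[ n ] Achieved 𝒮 (play σ τ n)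

Winner : (I → Polyomino) → Set _
Winner 𝒮 = (Bounded 𝒮 × MakerWins 𝒮)
         ⊎ (Unbounded 𝒮 × ∀ ℱ → BoundedRestriction ℱ 𝒮 → MakerWins ℱ)

Loser : (I → Polyomino) → Set _
Loser 𝒮 = ¬ Winner 𝒮

------------------------------------------------------------------------
-- Particular polyominoes

private
  origin : Cell
  origin = 0ℤ , 0ℤ

  step-sym : ∀ {A p q} → Step A p q → Step A q p
  step-sym {p = x₁ , y₁} {x₂ , y₂} (p∈A , q∈A , adj) =
    q∈A , p∈A ,
    trans (cong₂ ℕ._+_ (ℤ.∣i-j∣≡∣j-i∣ x₂ x₁) (ℤ.∣i-j∣≡∣j-i∣ y₂ y₁)) adj

  rooted : ∀ {A r} → (∀ {p} → p ∈ A → Star (Step A) r p) →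
           ∀ {p q} → p ∈ A → q ∈ A → Star (Step A) p q
  rooted {A} path p∈A q∈A = reverse (step-sym {A}) (path p∈A) ◅◅ path q∈A

  adj⁺ : ∀ n → Adjacent (+ n , 0ℤ) (+ suc n , 0ℤ)
  adj⁺ n = trans (ℕ.+-identityʳ _)
    (trans (cong ∣_∣ (ℤ.m-n≡m⊖n n (suc n)))
    (trans (ℤ.∣m⊖n∣≡∣n⊖m∣ n (suc n))
    (trans (cong ∣_∣ (ℤ.⊖-≥ (ℕ.n≤1+n n))) (ℕ.m+n∸n≡m 1 n))))

  adj⁻ : ∀ n → Adjacent (- + n , 0ℤ) (- + suc n , 0ℤ)
  adj⁻ zero    = refl
  adj⁻ (suc n) = trans (ℕ.+-identityʳ _)
    (trans (cong ∣_∣ (ℤ.⊖-≥ (ℕ.n≤1+n (suc n)))) (ℕ.m+n∸n≡m 1 n))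

fromList : (xs : List Cell) → origin List.∈ xs →
           All (Star (Step (List._∈ xs)) origin) xs → Polyomino
fromList xs o∈xs paths = record
  { cells     = List._∈ xs
  ; nonempty  = origin , o∈xs
  ; connected = rooted (All.lookup paths)
  }

-- {(0,0), …, (n-1,0)}
S : (n : ℕ) → .{{NonZero n}} → Polyomino
S n@(suc _) = record
  { cells     = row
  ; nonempty  = origin , 0 , z<s , refl
  ; connected = rooted λ { (i , i<n , refl) → path i i<n }
  }
  where
  row : Pred Cell 0ℓ
  row c = ∃[ i ] i ℕ.< n × c ≡ (+ i , 0ℤ)

  path : ∀ i → i ℕ.< n → Star (Step row) origin (+ i , 0ℤ)
  path zero    _     = ε
  path (suc i) 1+i<n = path i i<n ◅◅
    ((i , i<n , refl) , (suc i , 1+i<n , refl) , adj⁺ i) ◅ ε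
    where i<n = ℕ.<-trans (ℕ.n<1+n i) 1+i<n

-- {(i,0) ∣ i ≥ 0}
S∞ : Polyomino
S∞ = record
  { cells     = ray
  ; nonempty  = origin , 0 , refl
  ; connected = rooted λ { (i , refl) → path i }
  }
  where
  ray : Pred Cell 0ℓ
  ray c = ∃[ i ] c ≡ (+ i , 0ℤ)

  path : ∀ i → Star (Step ray) origin (+ i , 0ℤ)
  path zero    = ε
  path (suc i) = path i ◅◅ ((i , refl) , (suc i , refl) , adj⁺ i) ◅ ε

-- {(x,0) ∣ x ∈ ℤ}
Line : Polyomino
Line = record
  { cells     = line
  ; nonempty  = origin , 0ℤ , refl
  ; connected = rooted λ { (+ n , refl) → path⁺ n ; (-[1+ n ] , refl) → path⁻ (suc n) }
  }
  where
  line : Pred Cell 0ℓ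
  line c = ∃[ x ] c ≡ (x , 0ℤ)

  path⁺ : ∀ n → Star (Step line) origin (+ n , 0ℤ)
  path⁺ zero    = ε
  path⁺ (suc n) = path⁺ n ◅◅ ((_ , refl) , (_ , refl) , adj⁺ n) ◅ ε

  path⁻ : ∀ n → Star (Step line) origin (- + n , 0ℤ)
  path⁻ zero    = ε
  path⁻ (suc n) = path⁻ n ◅◅ ((_ , refl) , (_ , refl) , adj⁻ n) ◅ ε

private
  pattern 1st = here refl
  pattern 2nd = there (here refl)
  pattern 3rd = there (there (here refl))
  pattern 4th = there (there (there (here refl)))

L₂ : Polyomino
L₂ = fromList ((0ℤ , 0ℤ) ∷ (1ℤ , 0ℤ) ∷ (0ℤ , 1ℤ) ∷ []) 1st
  ( ε
  ∷ ((1st , 2nd , refl) ◅ ε)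
  ∷ ((1st , 3rd , refl) ◅ ε)
  ∷ [])

C₂ : Polyomino
C₂ = fromList ((0ℤ , 0ℤ) ∷ (1ℤ , 0ℤ) ∷ (0ℤ , 1ℤ) ∷ (1ℤ , 1ℤ) ∷ []) 1st
  ( ε
  ∷ ((1st , 2nd , refl) ◅ ε)
  ∷ ((1st , 3rd , refl) ◅ ε)
  ∷ ((1st , 2nd , refl) ◅ (2nd , 4th , refl) ◅ ε)
  ∷ [])

Z₂ : Polyomino
Z₂ = fromList ((0ℤ , 0ℤ) ∷ (1ℤ , 0ℤ) ∷ (0ℤ , 1ℤ) ∷ (1ℤ , -1ℤ) ∷ []) 1st
  ( ε
  ∷ ((1st , 2nd , refl) ◅ ε)
  ∷ ((1st , 3rd , refl) ◅ ε)
  ∷ ((1st , 2nd , refl) ◅ (2nd , 4th , refl) ◅ ε)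
  ∷ [])

𝒴₂ : Vector Polyomino 2
𝒴₂ = S∞ Vector.∷ L₂ Vector.∷ Vector.[]

𝒩₂₁ : Vector Polyomino 1
𝒩₂₁ = L₂ Vector.∷ Vector.[]

𝒩₂₂ : Vector Polyomino 2
𝒩₂₂ = S 3 Vector.∷ C₂ Vector.∷ Vector.[]

𝒩₂₃ : Vector Polyomino 2
𝒩₂₃ = S 3 Vector.∷ Z₂ Vector.∷ Vector.[]

-- The team {Line, L₂}, when 𝓕 is a team of size 2.  It has the same
-- bounded restrictions as 𝒴₂ up to congruence, but Line, being infinite
-- in both directions, is not an ancestor of S∞; so it is a winner that is
-- not simpler than 𝒴₂.
IsLineAndL₂ : Vector Polyomino 2 → Set
IsLineAndL₂ 𝓕 = (∃[ i ] 𝓕 i ≅ Line) × (∃[ j ] 𝓕 j ≅ L₂)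

{-# OPTIONS --safe #-}

-- A polyomino without a bend, that is, without a copy of L₂, is congruent to Line or to an initial
-- segment of the ray; so two such polyominoes are comparable.  Hence in a team of size 2, other
-- than {Line , L₂}, that is not simpler than 𝒴₂, either both members have a bend, or the straight
-- member contains S₃ and the other one properly contains L₂; in the latter case a neighbour of the
-- copy of L₂ completes a copy of S₃, C₂ or Z₂.
--
-- The breaker defeats 𝒩₂₁, 𝒩₂₂ and 𝒩₂₃ by pairing strategies: she fixes two perfect matchings of
-- the board by dominoes and answers each cell with its two partners, so that the maker never
-- completes a domino.  As the ancestors 𝒩₂ᵢ are finite, they also form a bounded restriction of
-- every unbounded set 𝒯 with 𝒩₂ᵢ ⪯ 𝒯.
--
-- The maker starts a row and bends it as soon as he can.  Otherwise all 2n cells beside his row of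
-- n ≥ 2 cells are marked; they exhaust the cells of the breaker, so the row can be prolonged.

module Submission where

open import Defs
open import Algebra.Definitions using (Commutative)
open import Axiom.ExcludedMiddle using (ExcludedMiddle)
open import Data.Bool.Base using (Bool; true; false; if_then_else_; _xor_)
open import Data.Empty using (⊥)
open import Data.Fin.Base as Fin using (Fin)
open import Data.Fin.Patterns using (0F; 1F; 2F; 3F)
import Data.Fin.Properties as Fin
open import Data.Integer.Base as ℤ using (ℤ; +_; -[1+_]; -_; ∣_∣; 0ℤ; 1ℤ; -1ℤ)
import Data.Integer.Properties as ℤ
open import Data.Integer.Tactic.RingSolver using (solve-∀)
open import Algebra.Properties.CommutativeSemigroup ℤ.+-commutativeSemigroup using (interchange)
open import Data.List.Base using (List; []; _∷_; map; length; lookup; allFin)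
import Data.List.Membership.DecPropositional as DecMembership
import Data.List.Membership.Propositional as List
import Data.List.Membership.Propositional.Properties as List
open import Data.List.Membership.Setoid.Properties using (index-injective)
import Data.List.Properties as List
import Data.List.Relation.Unary.All as All
import Data.List.Relation.Unary.All.Properties as All
open import Data.List.Relation.Unary.All using (All; []; _∷_)
open import Data.List.Relation.Unary.AllPairs using ([]; _∷_)
open import Data.List.Relation.Unary.Any using (here; there; index)
import Data.List.Relation.Unary.Unique.DecPropositional as DecUnique
open import Data.List.Relation.Unary.Unique.Propositional using (Unique)
import Data.List.Relation.Unary.Unique.Propositional.Properties as Unique
open import Data.Nat.Base as ℕ using (ℕ; zero; suc; z≤n; s≤s; parity)
import Data.Nat.Properties as ℕ
open import Data.Parity.Base as ℙ using (Parity; 0ℙ; 1ℙ)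
import Data.Parity.Properties as ℙ
open import Data.Product.Base using (∃-syntax; Σ-syntax; _×_; _,_; proj₁; proj₂)
open import Data.Product.Properties using (≡-dec)
open import Data.Sum.Base as Sum using (_⊎_; inj₁; inj₂; [_,_]′)
open import Data.Vec.Functional as Vector using (Vector)
open import Function.Base using (_∘_; id)
open import Function.Bundles using (_⇔_; mk⇔; Equivalence)
open import Level using (0ℓ)
open import Relation.Binary.Construct.Closure.ReflexiveTransitive using (Star; ε; _◅_; gmap)
open import Relation.Binary.Definitions using (DecidableEquality)
open import Relation.Binary.PropositionalEquality
open import Relation.Nullary.Decidable.Core using (Dec; yes; no; from-yes; ¬?; decidable-stable)
open import Relation.Nullary.Negation using (¬_; contradiction)
open import Relation.Unary using (Pred; _∈_; _∉_; _⊆_)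

-- The group of congruences

origin : Cell
origin = 0ℤ , 0ℤ

pattern ⟨_,_,_⟩ b k t = record { reflected = b ; quarterTurns = k ; translation = t }

flip : Bool → Cell → Cell
flip b c = if b then reflect c else c

translate-translate : ∀ s t c → translate s (translate t c) ≡ translate (translate s t) c
translate-translate (a , b) (a′ , b′) (x , y) =
  cong₂ _,_ (sym (ℤ.+-assoc a a′ x)) (sym (ℤ.+-assoc b b′ y))

translate-comm : ∀ c d → translate c d ≡ translate d c
translate-comm (a , b) (x , y) = cong₂ _,_ (ℤ.+-comm a x) (ℤ.+-comm b y)

turn-translate : ∀ k t c → turn k (translate t c) ≡ translate (turn k t) (turn k c)
turn-translate 0F _       _       = refl
turn-translate 1F (_ , b) (_ , y) = cong (_, _) (ℤ.neg-distrib-+ b y)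
turn-translate 2F (a , b) (x , y) = cong₂ _,_ (ℤ.neg-distrib-+ a x) (ℤ.neg-distrib-+ b y)
turn-translate 3F (a , _) (x , _) = cong (_ ,_) (ℤ.neg-distrib-+ a x)

flip-translate : ∀ b t c → flip b (translate t c) ≡ translate (flip b t) (flip b c)
flip-translate false _       _       = refl
flip-translate true  (_ , b) (_ , y) = cong (_ ,_) (ℤ.neg-distrib-+ b y)

quarter-turn : ∀ k → ∃[ l ] ∀ c → turn 1F (turn k c) ≡ turn l c
quarter-turn 0F = 1F , λ _ → refl
quarter-turn 1F = 2F , λ _ → refl
quarter-turn 2F = 3F , λ (_ , y) → cong (_, _) (ℤ.neg-involutive y)
quarter-turn 3F = 0F , λ (x , _) → cong (_, _) (ℤ.neg-involutive x)

-- Iterates `quarter-turn`: a half turn is two quarter turns by computation, and `turn 3F` is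
-- rewritten as a quarter turn after `turn 2F`.
turn-turn : ∀ j k → ∃[ l ] ∀ c → turn j (turn k c) ≡ turn l c
turn-turn 0F k = k , λ _ → refl
turn-turn 1F k = quarter-turn k
turn-turn 2F k =
  let l , eq = quarter-turn k ; m , eq′ = quarter-turn l in
  m , λ c → trans (cong (turn 1F) (eq c)) (eq′ c)
turn-turn 3F k =
  let l , eq = turn-turn 2F k ; m , eq′ = quarter-turn l in
  m , λ c → trans (sym (proj₂ (quarter-turn 2F) (turn k c)))
                  (trans (cong (turn 1F) (eq c)) (eq′ c))

-- A reflection conjugates a turn into the opposite turn.
flip-turn : ∀ b k → ∃[ l ] ∀ c → flip b (turn k c) ≡ turn l (flip b c)
flip-turn false k  = k  , λ _ → refl
flip-turn true  0F = 0F , λ _ → refl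
flip-turn true  1F = 3F , λ _ → refl
flip-turn true  2F = 2F , λ _ → refl
flip-turn true  3F = 1F , λ (x , y) →
  cong₂ _,_ (sym (ℤ.neg-involutive y)) (ℤ.neg-involutive x)

flip-flip : ∀ a b c → flip a (flip b c) ≡ flip (a xor b) c
flip-flip false _     _       = refl
flip-flip true  false _       = refl
flip-flip true  true  (_ , y) = cong (_ ,_) (ℤ.neg-involutive y)

-- The reflection and the turn of `g` are moved past the translation and the turn of `h`, until
-- reflections, turns and translations can each be merged.
compose : ∀ g h → ∃[ f ] ∀ c → f · c ≡ g · h · c
compose g h =
  let record { reflected = a ; quarterTurns = j ; translation = s } = g
      record { reflected = b ; quarterTurns = k ; translation = t } = h
      l , flipped = flip-turn a k
      m , turned  = turn-turn j l
      u = translate s (turn j (flip a t))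
  in ⟨ a xor b , m , u ⟩ , λ c → let open ≡-Reasoning in sym (begin
    translate s (turn j (flip a (translate t (turn k (flip b c)))))
      ≡⟨ cong (translate s ∘ turn j) (flip-translate a t _) ⟩
    translate s (turn j (translate (flip a t) (flip a (turn k (flip b c)))))
      ≡⟨ cong (translate s) (turn-translate j _ _) ⟩
    translate s (translate (turn j (flip a t)) (turn j (flip a (turn k (flip b c)))))
      ≡⟨ translate-translate s _ _ ⟩
    translate u (turn j (flip a (turn k (flip b c))))
      ≡⟨ cong (translate u ∘ turn j) (flipped (flip b c)) ⟩
    translate u (turn j (turn l (flip a (flip b c))))
      ≡⟨ cong (translate u) (turned (flip a (flip b c))) ⟩
    translate u (turn m (flip a (flip b c)))
      ≡⟨ cong (translate u ∘ turn m) (flip-flip a b c) ⟩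
    translate u (turn m (flip (a xor b) c)) ∎)

unturn : Fin 4 → Fin 4
unturn 0F = 0F
unturn 1F = 3F
unturn 2F = 2F
unturn 3F = 1F

turn-unturn : ∀ k c → turn k (turn (unturn k) c) ≡ c
turn-unturn 0F _       = refl
turn-unturn 1F (x , y) = cong (_, _) (ℤ.neg-involutive x)
turn-unturn 2F (x , y) = cong₂ _,_ (ℤ.neg-involutive x) (ℤ.neg-involutive y)
turn-unturn 3F (x , y) = cong (_ ,_) (ℤ.neg-involutive y)

flip-involutive : ∀ b c → flip b (flip b c) ≡ c
flip-involutive false _       = refl
flip-involutive true  (_ , y) = cong (_ ,_) (ℤ.neg-involutive y)

translate-cancel : ∀ t c → translate t (translate (turn 2F t) c) ≡ c
translate-cancel (a , b) (x , y) = cong₂ _,_ (cancel a x) (cancel b y)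
  where
  cancel : ∀ i j → i ℤ.+ (- i ℤ.+ j) ≡ j
  cancel i j = trans (sym (ℤ.+-assoc i (- i) j))
    (trans (cong (ℤ._+ j) (ℤ.+-inverseʳ i)) (ℤ.+-identityˡ j))

-- The inverse undoes the translation by `t`, then the turn, then the reflection; it is brought to
-- normal form by moving its translation outwards. `turn 2F t` is the vector opposite to `t`.
inverseʳ : ∀ g → ∃[ f ] ∀ c → g · f · c ≡ c
inverseʳ g =
  let record { reflected = b ; quarterTurns = k ; translation = t } = g
      k⁻ = unturn k
      t⁻ = turn 2F t
      l , flipped = flip-turn b k⁻
  in ⟨ b , l , flip b (turn k⁻ t⁻) ⟩ , λ c → let open ≡-Reasoning in begin
    translate t (turn k (flip b (translate (flip b (turn k⁻ t⁻)) (turn l (flip b c)))))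
      ≡⟨ cong (translate t ∘ turn k ∘ flip b ∘ translate (flip b (turn k⁻ t⁻))) (flipped c) ⟨
    translate t (turn k (flip b (translate (flip b (turn k⁻ t⁻)) (flip b (turn k⁻ c)))))
      ≡⟨ cong (translate t ∘ turn k ∘ flip b) (flip-translate b _ _) ⟨
    translate t (turn k (flip b (flip b (translate (turn k⁻ t⁻) (turn k⁻ c)))))
      ≡⟨ cong (translate t ∘ turn k) (flip-involutive b _) ⟩
    translate t (turn k (translate (turn k⁻ t⁻) (turn k⁻ c)))
      ≡⟨ cong (translate t ∘ turn k) (turn-translate k⁻ t⁻ c) ⟨
    translate t (turn k (turn k⁻ (translate t⁻ c)))
      ≡⟨ cong (translate t) (turn-unturn k _) ⟩
    translate t (translate t⁻ c)
      ≡⟨ translate-cancel t c ⟩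
    c ∎

infix 10 _⁻¹

_⁻¹ : Congruence → Congruence
g ⁻¹ = proj₁ (inverseʳ g)

·-inverseʳ : ∀ g c → g · g ⁻¹ · c ≡ c
·-inverseʳ g = proj₂ (inverseʳ g)

-- The group-theoretic argument: `g ⁻¹` has a right inverse too, so the right inverse of `g` is also
-- a left inverse.
·-inverseˡ : ∀ g c → g ⁻¹ · g · c ≡ c
·-inverseˡ g c = begin
  g ⁻¹ · g · c                      ≡⟨ cong (λ d → g ⁻¹ · g · d) (·-inverseʳ (g ⁻¹) c) ⟨
  g ⁻¹ · g · g ⁻¹ · (g ⁻¹) ⁻¹ · c   ≡⟨ cong (g ⁻¹ ·_) (·-inverseʳ g _) ⟩
  g ⁻¹ · (g ⁻¹) ⁻¹ · c              ≡⟨ ·-inverseʳ (g ⁻¹) c ⟩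
  c                                 ∎
  where open ≡-Reasoning

·-injective : ∀ g {c d} → g · c ≡ g · d → c ≡ d
·-injective g {c} {d} eq =
  trans (sym (·-inverseˡ g c)) (trans (cong (g ⁻¹ ·_) eq) (·-inverseˡ g d))

identity : Congruence
identity = ⟨ false , 0F , origin ⟩

identity· : ∀ c → identity · c ≡ c
identity· (x , y) = cong₂ _,_ (ℤ.+-identityˡ x) (ℤ.+-identityˡ y)

-- Distances invariant under congruences

distance : (ℕ → ℕ → ℕ) → Cell → Cell → ℕ
distance f (x₁ , y₁) (x₂ , y₂) = f ∣ x₁ ℤ.- x₂ ∣ ∣ y₁ ℤ.- y₂ ∣

module _ {f : ℕ → ℕ → ℕ} (f-comm : Commutative _≡_ f) where

  private
    ∣neg-neg∣ : ∀ x₁ x₂ → ∣ - x₁ ℤ.- - x₂ ∣ ≡ ∣ x₁ ℤ.- x₂ ∣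
    ∣neg-neg∣ x₁ x₂ =
      trans (cong ∣_∣ (sym (ℤ.neg-distrib-+ x₁ (- x₂)))) (ℤ.∣-i∣≡∣i∣ (x₁ ℤ.- x₂))

    shift : ∀ a x₁ x₂ → (a ℤ.+ x₁) ℤ.- (a ℤ.+ x₂) ≡ x₁ ℤ.- x₂
    shift = solve-∀

  distance-flip : ∀ b c d → distance f (flip b c) (flip b d) ≡ distance f c d
  distance-flip false _        _        = refl
  distance-flip true  (_ , y₁) (_ , y₂) = cong (f _) (∣neg-neg∣ y₁ y₂)

  distance-turn : ∀ k c d → distance f (turn k c) (turn k d) ≡ distance f c d
  distance-turn 0F _         _         = refl
  distance-turn 1F (_ , y₁)  (_ , y₂)  = trans (f-comm _ _) (cong (f _) (∣neg-neg∣ y₁ y₂))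
  distance-turn 2F (x₁ , y₁) (x₂ , y₂) = cong₂ f (∣neg-neg∣ x₁ x₂) (∣neg-neg∣ y₁ y₂)
  distance-turn 3F (x₁ , _)  (x₂ , _)  =
    trans (f-comm _ _) (cong (λ m → f m _) (∣neg-neg∣ x₁ x₂))

  distance-translate : ∀ t c d → distance f (translate t c) (translate t d) ≡ distance f c d
  distance-translate (a , b) (x₁ , y₁) (x₂ , y₂) =
    cong₂ (λ i j → f ∣ i ∣ ∣ j ∣) (shift a x₁ x₂) (shift b y₁ y₂)

  -- A congruence changes coordinate differences only in sign and, for odd turns, in order; the
  -- absolute values absorb the signs and `f-comm` the order. The sum gives adjacency; the product
  -- and the absolute difference separate small polyominoes.
  isometry : ∀ g c d → distance f (g · c) (g · d) ≡ distance f c d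
  isometry g c d =
    let record { reflected = b ; quarterTurns = k ; translation = t } = g in
    trans (distance-translate t _ _) (trans (distance-turn k _ _) (distance-flip b c d))

-- Ancestors and congruence of sets of cells

infix 4 _≼_ _≈_

-- Stated for arbitrary sets of cells, since the cells of the maker need not be connected.
record _≼_ (A B : Pred Cell 0ℓ) : Set where
  constructor via
  field
    congruence : Congruence
    maps       : ∀ {c} → c ∈ A → congruence · c ∈ B

record _≈_ (A B : Pred Cell 0ℓ) : Set where
  constructor via
  field
    congruence : Congruence
    maps       : ∀ c → c ∈ A ⇔ congruence · c ∈ B

private
  variable
    A B C : Pred Cell 0ℓ

⊆⇒≼ : A ⊆ B → A ≼ B
⊆⇒≼ {B = B} A⊆B = via identity λ {c} c∈A → subst B (sym (identity· c)) (A⊆B c∈A)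

≼-trans : A ≼ B → B ≼ C → A ≼ C
≼-trans {C = C} (via g A→B) (via h B→C) =
  let f , eq = compose h g in
  via f λ {c} c∈A → subst C (sym (eq c)) (B→C (A→B c∈A))

⊑⇒≼ : ∀ P Q → P ⊑ Q → cells P ≼ cells Q
⊑⇒≼ _ _ (g , P→Q) = via g P→Q

≼⇒⊑ : ∀ P Q → cells P ≼ cells Q → P ⊑ Q
≼⇒⊑ _ _ (via g P→Q) = g , P→Q

≈⇒≅ : ∀ P Q → cells P ≈ cells Q → P ≅ Q
≈⇒≅ _ _ (via g P⇔Q) = g , P⇔Q

⊆⇒≈ : A ⊆ B → B ⊆ A → A ≈ B
⊆⇒≈ {A} {B} A⊆B B⊆A = via identity λ c → mk⇔
  (λ c∈A → subst B (sym (identity· c)) (A⊆B c∈A))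
  (λ c∈B → B⊆A (subst B (identity· c) c∈B))

≈⇒≼ : A ≈ B → A ≼ B
≈⇒≼ (via g A⇔B) = via g λ {c} → Equivalence.to (A⇔B c)

≈-sym : A ≈ B → B ≈ A
≈-sym {B = B} (via g A⇔B) = via (g ⁻¹) λ c → mk⇔
  (λ c∈B → Equivalence.from (A⇔B (g ⁻¹ · c)) (subst B (sym (·-inverseʳ g c)) c∈B))
  (λ c∈A → subst B (·-inverseʳ g c) (Equivalence.to (A⇔B (g ⁻¹ · c)) c∈A))

≈⇒≽ : A ≈ B → B ≼ A
≈⇒≽ = ≈⇒≼ ∘ ≈-sym

≈-trans : A ≈ B → B ≈ C → A ≈ C
≈-trans {C = C} (via g A⇔B) (via h B⇔C) =
  let f , eq = compose h g in
  via f λ c → mk⇔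
    (λ c∈A → subst C (sym (eq c)) (Equivalence.to (B⇔C _) (Equivalence.to (A⇔B c) c∈A)))
    (λ c∈C → Equivalence.from (A⇔B c) (Equivalence.from (B⇔C _) (subst C (eq c) c∈C)))

-- `P` in the coordinates given by `g`; it serves to place a chosen cell of `P` at the origin, in a
-- chosen orientation.
pullback : Congruence → Polyomino → Polyomino
pullback g P = record
  { cells     = λ c → g · c ∈ cells P
  ; nonempty  = let c , c∈P = nonempty P in g ⁻¹ · c , pull c∈P
  ; connected = λ p∈ q∈ → subst₂ (Star _) (·-inverseˡ g _) (·-inverseˡ g _)
      (gmap (g ⁻¹ ·_)
        (λ {p} {q} (p∈P , q∈P , adj) →
          pull p∈P , pull q∈P , trans (isometry ℕ.+-comm (g ⁻¹) p q) adj)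
        (connected P p∈ q∈))
  }
  where
  pull : ∀ {c} → c ∈ cells P → g · g ⁻¹ · c ∈ cells P
  pull {c} = subst (cells P) (sym (·-inverseʳ g c))

≈-pullback : ∀ g P → cells P ≈ cells (pullback g P)
≈-pullback g P = ≈-sym (via g λ _ → mk⇔ id id)

-- Neighbours

unit : Fin 4 → Cell
unit k = turn k (1ℤ , 0ℤ)

adjacent⇒unit : ∀ p q → Adjacent p q → ∃[ k ] q ≡ translate p (unit k)
adjacent⇒unit (x₁ , y₁) (x₂ , y₂) adj with x₁ ℤ.- x₂ in dx | y₁ ℤ.- y₂ in dy
... | i | j = let k , ex , ey = unit-offset i j adj in
  k , cong₂ _,_ (trans (solved x₁ x₂) (cong (λ i → x₁ ℤ.+ i) (trans (cong -_ dx) ex)))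
                (trans (solved y₁ y₂) (cong (λ i → y₁ ℤ.+ i) (trans (cong -_ dy) ey)))
  where
  solved : ∀ i j → j ≡ i ℤ.+ - (i ℤ.- j)
  solved = solve-∀

  unit-offset : ∀ i j → ∣ i ∣ ℕ.+ ∣ j ∣ ≡ 1 →
    ∃[ k ] (- i ≡ proj₁ (unit k) × - j ≡ proj₂ (unit k))
  unit-offset (+ 0) (+ 1)     refl = 3F , refl , refl
  unit-offset (+ 0) -[1+ 0 ]  refl = 1F , refl , refl
  unit-offset (+ 1) (+ 0)     refl = 2F , refl , refl
  unit-offset -[1+ 0 ] (+ 0)  refl = 0F , refl , refl

-- Connectedness as an induction principle: the property `Q` is carried along a path from `r`, one
-- unit vector at a time.
neighbour-induction : (P : Polyomino) (Q : Pred Cell 0ℓ) {r : Cell} → r ∈ cells P → r ∈ Q →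
  (∀ {c} k → c ∈ cells P → c ∈ Q → translate c (unit k) ∈ cells P → translate c (unit k) ∈ Q) →
  cells P ⊆ Q
neighbour-induction P Q r∈P r∈Q step c∈P = along (connected P r∈P c∈P) r∈Q
  where
  along : ∀ {p q} → Star (Step (cells P)) p q → p ∈ Q → q ∈ Q
  along ε p∈Q = p∈Q
  along (_◅_ {p} {q} (p∈P , q∈P , adj) path) p∈Q with adjacent⇒unit p q adj
  ... | k , refl = along path (step k p∈P p∈Q q∈P)

-- Copies of small polyominoes

·-origin : ∀ b k t → ⟨ b , k , t ⟩ · origin ≡ t
·-origin b k t@(x , y) =
  trans (cong (translate t) (fixed b k)) (cong₂ _,_ (ℤ.+-identityʳ x) (ℤ.+-identityʳ y))
  where
  fixed : ∀ b k → turn k (flip b origin) ≡ origin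
  fixed false 0F = refl
  fixed false 1F = refl
  fixed false 2F = refl
  fixed false 3F = refl
  fixed true  0F = refl
  fixed true  1F = refl
  fixed true  2F = refl
  fixed true  3F = refl

L₂≼ : ∀ g → g · origin ∈ A → g · (1ℤ , 0ℤ) ∈ A → g · (0ℤ , 1ℤ) ∈ A → cells L₂ ≼ A
L₂≼ g p q r = via g λ
  { (here refl)                 → p
  ; (there (here refl))         → q
  ; (there (there (here refl))) → r
  }

corner : ∀ k {c} → c ∈ A → translate c (turn k (1ℤ , 0ℤ)) ∈ A →
         translate c (turn k (0ℤ , 1ℤ)) ∈ A → cells L₂ ≼ A
corner {A} k {c} c∈A = L₂≼ ⟨ false , k , c ⟩ (subst A (sym (·-origin false k c)) c∈A)

S₃≼ : ∀ g → g · origin ∈ A → g · (1ℤ , 0ℤ) ∈ A → g · (+ 2 , 0ℤ) ∈ A → cells (S 3) ≼ A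
S₃≼ g p q r = via g λ
  { (0 , _ , refl) → p
  ; (1 , _ , refl) → q
  ; (2 , _ , refl) → r
  ; (suc (suc (suc _)) , s≤s (s≤s (s≤s ())) , _)
  }

C₂≼ : ∀ g → g · origin ∈ A → g · (1ℤ , 0ℤ) ∈ A → g · (0ℤ , 1ℤ) ∈ A → g · (1ℤ , 1ℤ) ∈ A →
      cells C₂ ≼ A
C₂≼ g p q r s = via g λ
  { (here refl)                         → p
  ; (there (here refl))                 → q
  ; (there (there (here refl)))         → r
  ; (there (there (there (here refl)))) → s
  }

Z₂≼ : ∀ g → g · origin ∈ A → g · (1ℤ , 0ℤ) ∈ A → g · (0ℤ , 1ℤ) ∈ A → g · (1ℤ , -1ℤ) ∈ A →
      cells Z₂ ≼ A
Z₂≼ g p q r s = via g λ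
  { (here refl)                         → p
  ; (there (here refl))                 → q
  ; (there (there (here refl)))         → r
  ; (there (there (there (here refl)))) → s
  }

-- Polyominoes without a bend

-- For a down-closed `X` this is an initial segment of the ray, so that finite rows and the ray
-- itself are treated alike.
Segment : Pred ℕ 0ℓ → Pred Cell 0ℓ
Segment X c = ∃[ i ] i ∈ X × c ≡ (+ i , 0ℤ)

DownClosed : Pred ℕ 0ℓ → Set
DownClosed X = ∀ {i j} → j ℕ.≤ i → i ∈ X → j ∈ X

Straight : Pred Cell 0ℓ → Set₁
Straight A = A ≈ cells Line ⊎ Σ[ X ∈ Pred ℕ 0ℓ ] DownClosed X × A ≈ Segment X

straight-resp-≈ : A ≈ B → Straight B → Straight A
straight-resp-≈ A≈B (inj₁ B≈Line)           = inj₁ (≈-trans A≈B B≈Line)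
straight-resp-≈ A≈B (inj₂ (X , down , B≈X)) = inj₂ (X , down , ≈-trans A≈B B≈X)

Row : Pred Cell 0ℓ → Set
Row A = ∀ {x y} → (x , y) ∈ A → y ≡ 0ℤ

x+1-1 : ∀ x → (x ℤ.+ 1ℤ) ℤ.+ -1ℤ ≡ x
x+1-1 x = trans (ℤ.+-assoc x 1ℤ -1ℤ) (ℤ.+-identityʳ x)

x-1+1 : ∀ x → (x ℤ.+ -1ℤ) ℤ.+ 1ℤ ≡ x
x-1+1 x = trans (ℤ.+-assoc x -1ℤ 1ℤ) (ℤ.+-identityʳ x)

-- The invariant `Q` also records a horizontal neighbour in `P` of each cell reached. Together with
-- a vertical neighbour it would form a bend, so no path leaves the row.
domino⇒row : ∀ P → origin ∈ cells P → unit 0F ∈ cells P → ¬ cells L₂ ≼ cells P → Row (cells P)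
domino⇒row P origin∈P unit∈P L₂⋠P =
  proj₁ ∘ neighbour-induction P Q origin∈P (refl , inj₁ unit∈P) step
  where
  Q : Pred Cell 0ℓ
  Q (x , y) = y ≡ 0ℤ × ((x ℤ.+ 1ℤ , 0ℤ) ∈ cells P ⊎ (x ℤ.+ -1ℤ , 0ℤ) ∈ cells P)

  step : ∀ {c} k → c ∈ cells P → c ∈ Q → translate c (unit k) ∈ cells P → translate c (unit k) ∈ Q
  step {x , _} 0F c∈P (refl , _)      _   =
    refl , inj₂ (subst (λ z → (z , 0ℤ) ∈ cells P) (sym (x+1-1 x)) c∈P)
  step         1F c∈P (refl , inj₁ r) n∈P = contradiction (corner 0F c∈P r n∈P) L₂⋠P
  step         1F c∈P (refl , inj₂ l) n∈P = contradiction (corner 1F c∈P n∈P l) L₂⋠P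
  step {x , _} 2F c∈P (refl , _)      _   =
    refl , inj₁ (subst (λ z → (z , 0ℤ) ∈ cells P) (sym (x-1+1 x)) c∈P)
  step         3F c∈P (refl , inj₁ r) n∈P = contradiction (corner 3F c∈P n∈P r) L₂⋠P
  step         3F c∈P (refl , inj₂ l) n∈P = contradiction (corner 2F c∈P l n∈P) L₂⋠P

-- The origin is the left end. The invariant records all cells between the origin and the cell
-- reached, which makes `X` down-closed.
ended-row⇒straight : ∀ P → origin ∈ cells P → Row (cells P) → (-1ℤ , 0ℤ) ∉ cells P →
  Straight (cells P)
ended-row⇒straight P origin∈P row end = inj₂ (X , down , ⊆⇒≈ P⊆X λ { (_ , i∈X , refl) → i∈X })
  where
  X : Pred ℕ 0ℓ
  X i = (+ i , 0ℤ) ∈ cells P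

  Q : Pred Cell 0ℓ
  Q c = ∃[ i ] c ≡ (+ i , 0ℤ) × (∀ {j} → j ℕ.≤ i → j ∈ X)

  step : ∀ {c} k → c ∈ cells P → c ∈ Q → translate c (unit k) ∈ cells P → translate c (unit k) ∈ Q
  step 0F _ (i , refl , below) n∈P rewrite ℕ.+-comm i 1 =
    suc i , refl , λ j≤1+i → extend (ℕ.m≤n⇒m<n∨m≡n j≤1+i)
    where
    extend : ∀ {j} → j ℕ.< suc i ⊎ j ≡ suc i → j ∈ X
    extend (inj₁ (s≤s j≤i)) = below j≤i
    extend (inj₂ refl)      = n∈P
  step 1F _ (_ , refl , _) n∈P = contradiction (row n∈P) λ ()
  -- To the left of the origin lies the cell that `end` excludes.
  step 2F _ (zero  , refl , _)     n∈P = contradiction n∈P end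
  step 2F _ (suc i , refl , below) _   = i , refl , λ j≤i → below (ℕ.m≤n⇒m≤1+n j≤i)
  step 3F _ (_ , refl , _) n∈P = contradiction (row n∈P) λ ()

  initial : cells P ⊆ Q
  initial = neighbour-induction P Q origin∈P (0 , refl , λ { z≤n → origin∈P }) step

  down : DownClosed X
  down j≤i i∈X with initial i∈X
  ... | _ , refl , below = below j≤i

  P⊆X : cells P ⊆ Segment X
  P⊆X c∈P with initial c∈P
  ... | i , refl , below = i , below ℕ.≤-refl , refl

endless-row⇒line : origin ∈ A → Row A →
  (∀ x → (x , 0ℤ) ∈ A → (x ℤ.+ 1ℤ , 0ℤ) ∈ A) →
  (∀ x → (x , 0ℤ) ∈ A → (x ℤ.+ -1ℤ , 0ℤ) ∈ A) → A ≈ cells Line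
endless-row⇒line {A} origin∈A row right left =
  ⊆⇒≈ (λ { {x , _} c∈A → x , cong (x ,_) (row c∈A) })
        λ { (+ n , refl) → rightwards n ; (-[1+ n ] , refl) → leftwards n }
  where
  rightwards : ∀ n → (+ n , 0ℤ) ∈ A
  rightwards zero    = origin∈A
  rightwards (suc n) =
    subst (λ m → (+ m , 0ℤ) ∈ A) (ℕ.+-comm n 1) (right (+ n) (rightwards n))

  leftwards : ∀ n → (-[1+ n ] , 0ℤ) ∈ A
  leftwards zero    = left 0ℤ origin∈A
  leftwards (suc n) =
    subst (λ m → (-[1+ suc m ] , 0ℤ) ∈ A) (ℕ.+-identityʳ n) (left -[1+ n ] (leftwards n))

module Classical (em : ExcludedMiddle 0ℓ) where

  -- A left end, if there is one, is moved to the origin; so is a right end, with a half turn that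
  -- makes it a left end. A row without ends is the whole line.
  row⇒straight : ∀ P → origin ∈ cells P → Row (cells P) → Straight (cells P)
  row⇒straight P origin∈P row
    with em {∃[ x ] (x , 0ℤ) ∈ cells P × (x ℤ.+ -1ℤ , 0ℤ) ∉ cells P}
       | em {∃[ x ] (x , 0ℤ) ∈ cells P × (x ℤ.+ 1ℤ , 0ℤ) ∉ cells P}
  ... | yes (x , x∈P , end) | _ =
    straight-resp-≈ (≈-pullback g P) (ended-row⇒straight P′
      (subst (cells P) (sym (·-origin false 0F (x , 0ℤ))) x∈P)
      (λ {_} {y} c∈P → trans (sym (ℤ.+-identityˡ y)) (row c∈P))
      end)
    where
    g = ⟨ false , 0F , (x , 0ℤ) ⟩
    P′ = pullback g P
  ... | no _ | yes (x , x∈P , end) =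
    straight-resp-≈ (≈-pullback g P) (ended-row⇒straight P′
      (subst (cells P) (sym (·-origin false 2F (x , 0ℤ))) x∈P)
      (λ {_} {y} c∈P → ℤ.neg-injective (trans (sym (ℤ.+-identityˡ (- y))) (row c∈P)))
      end)
    where
    g = ⟨ false , 2F , (x , 0ℤ) ⟩
    P′ = pullback g P
  ... | no ¬left | no ¬right = inj₁ (endless-row⇒line origin∈P row
    (λ x x∈P → decidable-stable em λ x∉P → ¬right (x , x∈P , x∉P))
    (λ x x∈P → decidable-stable em λ x∉P → ¬left  (x , x∈P , x∉P)))

  -- If `p` has a neighbour in `P`, the two are moved to the origin and the cell on its right;
  -- otherwise `P` consists of `p` alone.
  unbent⇒straight : ∀ P → ¬ cells L₂ ≼ cells P → Straight (cells P)
  unbent⇒straight P L₂⋠P with nonempty P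
  ... | p , p∈P with em {∃[ k ] translate p (unit k) ∈ cells P}
  ...   | yes (k , n∈P) =
    straight-resp-≈ (≈-pullback g P)
      (row⇒straight P′ origin∈P′ (domino⇒row P′ origin∈P′ n∈P
        λ L₂≼P′ → L₂⋠P (≼-trans L₂≼P′ (≈⇒≽ (≈-pullback g P)))))
    where
    g = ⟨ false , k , p ⟩
    P′ = pullback g P
    origin∈P′ = subst (cells P) (sym (·-origin false k p)) p∈P
  ...   | no isolated =
    straight-resp-≈ (≈-pullback g P)
      (row⇒straight P′ origin∈P′ λ c∈P′ → cong proj₂
        (neighbour-induction P′ (_≡ origin) origin∈P′ refl
          (λ { k _ refl n∈P′ → contradiction (k , from-origin k n∈P′) isolated }) c∈P′))
    where
    g = ⟨ false , 0F , p ⟩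
    P′ = pullback g P
    origin∈P′ = subst (cells P) (sym (·-origin false 0F p)) p∈P

    from-origin : ∀ k → translate origin (unit k) ∈ cells P′ → translate p (unit k) ∈ cells P
    from-origin k = subst (λ c → translate p c ∈ cells P) (identity· (unit k))

  straight≼line : Straight A → A ≼ cells Line
  straight≼line (inj₁ A≈Line)        = ≈⇒≼ A≈Line
  straight≼line (inj₂ (X , _ , A≈X)) =
    ≼-trans (≈⇒≼ A≈X) (⊆⇒≼ {Segment X} λ { (i , _ , refl) → + i , refl })

  -- Down-closed sets of natural numbers are linearly ordered by inclusion, and every straight set
  -- fits into the line.
  straight-comparable : Straight A → Straight B → A ≼ B ⊎ B ≼ A
  straight-comparable (inj₁ A≈Line) B-straight =
    inj₂ (≼-trans (straight≼line B-straight) (≈⇒≽ A≈Line))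
  straight-comparable A-straight@(inj₂ _) (inj₁ B≈Line) =
    inj₁ (≼-trans (straight≼line A-straight) (≈⇒≽ B≈Line))
  straight-comparable (inj₂ (X , X-down , A≈X)) (inj₂ (Y , Y-down , B≈Y))
    with em {∃[ i ] i ∈ X × i ∉ Y}
  ... | yes (i , i∈X , i∉Y) = inj₂ (≼-trans (≈⇒≼ B≈Y) (≼-trans Y≼X (≈⇒≽ A≈X)))
    where
    Y≤i : ∀ {j} → j ∈ Y → j ℕ.≤ i
    Y≤i j∈Y = ℕ.≮⇒≥ λ i<j → i∉Y (Y-down (ℕ.<⇒≤ i<j) j∈Y)

    Y≼X : Segment Y ≼ Segment X
    Y≼X = ⊆⇒≼ λ { (j , j∈Y , refl) → j , X-down (Y≤i j∈Y) i∈X , refl }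
  ... | no X⊆Y = inj₁ (≼-trans (≈⇒≼ A≈X) (≼-trans X≼Y (≈⇒≽ B≈Y)))
    where
    X≼Y : Segment X ≼ Segment Y
    X≼Y = ⊆⇒≼ λ { (j , j∈X , refl) → j , decidable-stable em (λ j∉Y → X⊆Y (j , j∈X , j∉Y)) , refl }

  -- Without the number 2 a segment has at most two cells and fits into an arm of `L₂`; in a team
  -- this excludes that the other member has a bend.
  S₃≼straight⊎straight≼L₂ : Straight A → cells (S 3) ≼ A ⊎ A ≼ cells L₂
  S₃≼straight⊎straight≼L₂ (inj₁ A≈Line) =
    inj₁ (≼-trans (⊆⇒≼ λ { (i , _ , refl) → + i , refl }) (≈⇒≽ A≈Line))
  S₃≼straight⊎straight≼L₂ (inj₂ (X , down , A≈X)) with em {2 ∈ X}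
  ... | yes 2∈X = inj₁ (≼-trans S₃≼X (≈⇒≽ A≈X))
    where
    S₃≼X : cells (S 3) ≼ Segment X
    S₃≼X = ⊆⇒≼ λ { (i , s≤s i≤2 , refl) → i , down i≤2 2∈X , refl }
  ... | no 2∉X = inj₂ (≼-trans (≈⇒≼ A≈X) (⊆⇒≼ {Segment X} λ
    { (0 , _ , refl)           → here refl
    ; (1 , _ , refl)           → there (here refl)
    ; (suc (suc i) , i∈X , _)  → contradiction (down (s≤s (s≤s z≤n)) i∈X) 2∉X
    }))

  -- Seven cells adjoin the copy of `L₂`: four of them complete `S 3`, one completes `C₂` and two
  -- complete `Z₂`. If these are all excluded, the induction over neighbours never leaves `L₂`.
  bent : ∀ P → cells L₂ ≼ cells P →
    cells (S 3) ≼ cells P ⊎ cells C₂ ≼ cells P ⊎ cells Z₂ ≼ cells P ⊎ cells P ≈ cells L₂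
  bent P (via g L₂→P)
    with em {cells (S 3) ≼ cells P} | em {cells C₂ ≼ cells P} | em {cells Z₂ ≼ cells P}
  ... | yes S₃≼P | _ | _ = inj₁ S₃≼P
  ... | no _ | yes C₂≼P | _ = inj₂ (inj₁ C₂≼P)
  ... | no _ | no _ | yes Z₂≼P = inj₂ (inj₂ (inj₁ Z₂≼P))
  ... | no S₃⋠P | no C₂⋠P | no Z₂⋠P = inj₂ (inj₂ (inj₂
    (≈-trans (≈-pullback g P) (⊆⇒≈ (neighbour-induction P′ (cells L₂) o (here refl) step) L₂→P))))
    where
    P′ = pullback g P

    o = L₂→P (here refl)
    e = L₂→P (there (here refl))
    n = L₂→P (there (there (here refl)))

    excluded : ∀ {T : Set} → ¬ A ≼ cells P → A ≼ cells P′ → T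
    excluded A⋠P A≼P′ = contradiction (≼-trans A≼P′ (≈⇒≽ (≈-pullback g P))) A⋠P

    step : ∀ {c} k → c ∈ cells P′ → c ∈ cells L₂ →
           translate c (unit k) ∈ cells P′ → translate c (unit k) ∈ cells L₂
    step 0F _ (here refl) _ = there (here refl)
    step 1F _ (here refl) _ = there (there (here refl))
    step 2F _ (here refl) w = excluded S₃⋠P (S₃≼ ⟨ false , 0F , (-1ℤ , 0ℤ) ⟩ w o e)
    step 3F _ (here refl) s = excluded S₃⋠P (S₃≼ ⟨ false , 1F , (0ℤ , -1ℤ) ⟩ s o n)
    step 0F _ (there (here refl)) ee = excluded S₃⋠P (S₃≼ identity o e ee)
    step 1F _ (there (here refl)) ne = excluded C₂⋠P (C₂≼ identity o e n ne)
    step 2F _ (there (here refl)) _  = here refl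
    step 3F _ (there (here refl)) se = excluded Z₂⋠P (Z₂≼ identity o e n se)
    step 0F _ (there (there (here refl))) ne = excluded C₂⋠P (C₂≼ identity o e n ne)
    step 1F _ (there (there (here refl))) nn = excluded S₃⋠P (S₃≼ ⟨ false , 1F , origin ⟩ o n nn)
    -- A reflection followed by a quarter turn exchanges the coordinates, so the cell (-1,1) takes
    -- the role of (1,-1).
    step 2F _ (there (there (here refl))) nw = excluded Z₂⋠P (Z₂≼ ⟨ true , 1F , origin ⟩ o n e nw)
    step 3F _ (there (there (here refl))) _  = here refl

-- Deciding equality of cells and finding unmarked ones

_≟ᶜ_ : DecidableEquality Cell
_≟ᶜ_ = ≡-dec ℤ._≟_ ℤ._≟_

abscissae-bounded : ∀ xs → ∃[ n ] ∀ {c : Cell} → c List.∈ xs → ∣ proj₁ c ∣ ℕ.< n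
abscissae-bounded []             = 0 , λ ()
abscissae-bounded ((x , _) ∷ xs) = let n , bound = abscissae-bounded xs in
  suc ∣ x ∣ ℕ.+ n , λ
    { (here refl)  → ℕ.m≤m+n (suc ∣ x ∣) n
    ; (there c∈xs) → ℕ.≤-trans (bound c∈xs) (ℕ.m≤n+m n (suc ∣ x ∣))
    }

fresh : ∀ xs → ∃[ c ] c List.∉ xs
fresh xs = let n , bound = abscissae-bounded xs in
  (+ n , 0ℤ) , λ c∈xs → ℕ.<-irrefl refl (bound c∈xs)

-- Pairing strategies of the breaker

-- Lowering both numbers by one preserves their difference and lowers their sum by two.
parity-⊖ : ∀ m n → parity ∣ m ℤ.⊖ n ∣ ≡ parity m ℙ.+ parity n
parity-⊖ zero    zero    = refl
parity-⊖ zero    (suc n) = refl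
parity-⊖ (suc m) zero    = sym (ℙ.+-identityʳ (parity (suc m)))
parity-⊖ (suc m) (suc n) = begin
  parity ∣ suc m ℤ.⊖ suc n ∣       ≡⟨ cong (parity ∘ ∣_∣) (ℤ.[1+m]⊖[1+n]≡m⊖n m n) ⟩
  parity ∣ m ℤ.⊖ n ∣               ≡⟨ parity-⊖ m n ⟩
  parity m ℙ.+ parity n            ≡⟨ ℙ.+-homo-+ m n ⟨
  parity (suc (suc (m ℕ.+ n)))     ≡⟨ cong (parity ∘ suc) (ℕ.+-suc m n) ⟨
  parity (suc m ℕ.+ suc n)         ≡⟨ ℙ.+-homo-+ (suc m) (suc n) ⟩
  parity (suc m) ℙ.+ parity (suc n) ∎
  where open ≡-Reasoning

parityℤ : ℤ → Parity
parityℤ i = parity ∣ i ∣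

parityℤ-+ : ∀ i j → parityℤ (i ℤ.+ j) ≡ parityℤ i ℙ.+ parityℤ j
parityℤ-+ (+ m)    (+ n)    = ℙ.+-homo-+ m n
parityℤ-+ (+ m)    -[1+ n ] = parity-⊖ m (suc n)
parityℤ-+ -[1+ m ] (+ n)    = trans (parity-⊖ n (suc m)) (ℙ.+-comm (parity n) _)
parityℤ-+ -[1+ m ] -[1+ n ] =
  trans (cong (parity ∘ suc) (sym (ℕ.+-suc m n))) (ℙ.+-homo-+ (suc m) (suc n))

-- A perfect matching of the board by dominoes parallel to the axis; the
-- cells of colour 0ℙ are the initial cells of these dominoes.
record Matching : Set where
  field
    axis            : Cell
    offset          : Parity
    slope           : Cell → Parity
    slope-translate : ∀ c d → slope (translate c d) ≡ slope c ℙ.+ slope d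
    slope-axis      : slope axis ≡ 1ℙ

  -- As `slope` is additive and odd at the axis, a step along the axis in either direction changes
  -- the colour. Hence initial cells are matched with final ones.
  colour : Cell → Parity
  colour c = offset ℙ.+ slope c

  partner : Cell → Cell
  partner c with colour c
  ... | 0ℙ = translate c axis
  ... | 1ℙ = translate c (turn 2F axis)

  colour-translate : ∀ c d → colour (translate c d) ≡ colour c ℙ.+ slope d
  colour-translate c d =
    trans (cong (offset ℙ.+_) (slope-translate c d)) (sym (ℙ.+-assoc offset (slope c) (slope d)))

  forth-back : ∀ c → translate (translate c axis) (turn 2F axis) ≡ c
  forth-back c = begin
    translate (translate c axis) (turn 2F axis)
      ≡⟨ translate-comm _ (turn 2F axis) ⟩
    translate (turn 2F axis) (translate c axis)
      ≡⟨ cong (translate (turn 2F axis)) (translate-comm c axis) ⟩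
    translate (turn 2F axis) (translate axis c)
      -- The axis is written as the opposite of its opposite, so that `translate-cancel` applies to
      -- `turn 2F axis`.
      ≡⟨ cong (λ d → translate (turn 2F axis) (translate d c)) (turn-unturn 2F axis) ⟨
    translate (turn 2F axis) (translate (turn 2F (turn 2F axis)) c)
      ≡⟨ translate-cancel (turn 2F axis) c ⟩
    c ∎
    where open ≡-Reasoning

  back-forth : ∀ c → translate (translate c (turn 2F axis)) axis ≡ c
  back-forth c = begin
    translate (translate c (turn 2F axis)) axis  ≡⟨ translate-comm _ axis ⟩
    translate axis (translate c (turn 2F axis))  ≡⟨ cong (translate axis) (translate-comm c _) ⟩
    translate axis (translate (turn 2F axis) c)  ≡⟨ translate-cancel axis c ⟩
    c ∎
    where open ≡-Reasoning

  partner-initial : ∀ c → colour c ≡ 0ℙ → partner c ≡ translate c axis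
  partner-initial c eq with colour c | eq
  ... | _ | refl = refl

  partner-final : ∀ c → colour c ≡ 1ℙ → partner c ≡ translate c (turn 2F axis)
  partner-final c eq with colour c | eq
  ... | _ | refl = refl

  slope-forth : ∀ c → slope (translate c axis) ≡ slope c ℙ.⁻¹
  slope-forth c =
    trans (slope-translate c axis) (trans (cong (slope c ℙ.+_) slope-axis) (ℙ.+-comm (slope c) 1ℙ))

  colour-forth : ∀ c → colour (translate c axis) ≡ colour c ℙ.+ 1ℙ
  colour-forth c = trans (colour-translate c axis) (cong (colour c ℙ.+_) slope-axis)

  colour-back : ∀ c → colour (translate c (turn 2F axis)) ≡ colour c ℙ.+ 1ℙ
  colour-back c = ℙ.+-cancelʳ-≡ 1ℙ _ _ (begin
    colour (translate c (turn 2F axis)) ℙ.+ 1ℙ            ≡⟨ colour-forth _ ⟨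
    colour (translate (translate c (turn 2F axis)) axis)  ≡⟨ cong colour (back-forth c) ⟩
    colour c                                              ≡⟨ ℙ.+-identityʳ (colour c) ⟨
    colour c ℙ.+ 0ℙ                                       ≡⟨ ℙ.+-assoc (colour c) 1ℙ 1ℙ ⟨
    (colour c ℙ.+ 1ℙ) ℙ.+ 1ℙ                              ∎)
    where open ≡-Reasoning

  partner-involutive : ∀ c → partner (partner c) ≡ c
  partner-involutive c with colour c in eq
  ... | 0ℙ = trans (partner-final _ (trans (colour-forth c) (cong (ℙ._+ 1ℙ) eq))) (forth-back c)
  ... | 1ℙ = trans (partner-initial _ (trans (colour-back c) (cong (ℙ._+ 1ℙ) eq))) (back-forth c)

  colour-partner : ∀ c → colour (partner c) ≡ colour c ℙ.+ 1ℙ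
  colour-partner c with colour c in eq
  ... | 0ℙ = trans (colour-forth c) (cong (ℙ._+ 1ℙ) eq)
  ... | 1ℙ = trans (colour-back c) (cong (ℙ._+ 1ℙ) eq)

  partner-irreflexive : ∀ c → partner c ≢ c
  partner-irreflexive c eq =
    p+1≢p (colour c) (trans (sym (colour-partner c)) (cong colour eq))
    where
    p+1≢p : ∀ p → p ℙ.+ 1ℙ ≢ p
    p+1≢p 0ℙ ()
    p+1≢p 1ℙ ()

  private
    half-initial : ∀ p q → p ℙ.+ q ≡ 0ℙ ⊎ p ℙ.+ q ℙ.⁻¹ ≡ 0ℙ
    half-initial 0ℙ 0ℙ = inj₁ refl
    half-initial 0ℙ 1ℙ = inj₂ refl
    half-initial 1ℙ 0ℙ = inj₂ refl
    half-initial 1ℙ 1ℙ = inj₁ refl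

    partner-at : ∀ t d → colour t ℙ.+ slope d ≡ 0ℙ →
      partner (translate t d) ≡ translate t (translate d axis)
    partner-at t d eq = trans (partner-initial _ (trans (colour-translate t d) eq))
                              (sym (translate-translate t d axis))

  -- Whatever `t` is, the translates of `d` and `e` differ in colour, so one of them is initial.
  -- This treats all translates of a polyomino at once.
  matched : ∀ t d e → slope e ≡ slope d ℙ.⁻¹ →
    partner (translate t d) ≡ translate t (translate d axis) ⊎
    partner (translate t e) ≡ translate t (translate e axis)
  matched t d e eq with half-initial (colour t) (slope d)
  ... | inj₁ d-initial = inj₁ (partner-at t d d-initial)
  ... | inj₂ e-initial = inj₂ (partner-at t e (trans (cong (colour t ℙ.+_) eq) e-initial))

open Matching

module Pairing (M N : Matching) where

  Edge : Cell → Cell → Set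
  Edge c d = d ≡ partner M c ⊎ d ≡ partner N c

  edge-sym : ∀ {c d} → Edge c d → Edge d c
  edge-sym (inj₁ refl) = inj₁ (sym (partner-involutive M _))
  edge-sym (inj₂ refl) = inj₂ (sym (partner-involutive N _))

  edge-irrefl : ∀ c → ¬ Edge c c
  edge-irrefl c (inj₁ eq) = partner-irreflexive M c (sym eq)
  edge-irrefl c (inj₂ eq) = partner-irreflexive N c (sym eq)

  matched₁ : ∀ t d e → slope M e ≡ slope M d ℙ.⁻¹ →
    Edge (translate t d) (translate t (translate d (axis M))) ⊎
    Edge (translate t e) (translate t (translate e (axis M)))
  matched₁ t d e eq = Sum.map (inj₁ ∘ sym) (inj₁ ∘ sym) (matched M t d e eq)

  matched₂ : ∀ t d e → slope N e ≡ slope N d ℙ.⁻¹ →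
    Edge (translate t d) (translate t (translate d (axis N))) ⊎
    Edge (translate t e) (translate t (translate e (axis N)))
  matched₂ t d e eq = Sum.map (inj₂ ∘ sym) (inj₂ ∘ sym) (matched N t d e eq)

  consecutive₁ : ∀ {u} → axis M ≡ u → ∀ t d →
    Edge (translate t d) (translate t (translate d u)) ⊎
    Edge (translate t (translate d u)) (translate t (translate (translate d u) u))
  consecutive₁ refl t d = matched₁ t d (translate d (axis M)) (slope-forth M d)

  consecutive₂ : ∀ {u} → axis N ≡ u → ∀ t d →
    Edge (translate t d) (translate t (translate d u)) ⊎
    Edge (translate t (translate d u)) (translate t (translate (translate d u) u))
  consecutive₂ refl t d = matched₂ t d (translate d (axis N)) (slope-forth N d)

  Independent : Pred Cell 0ℓ → Set
  Independent A = ∀ {c d} → c ∈ A → d ∈ A → ¬ Edge c d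

  Blocks : Polyomino → Set₁
  Blocks P = ∀ {A} → Independent A → ¬ cells P ≼ A

  private
    reply : ∀ xs (c : Cell) → ∃[ b ] b List.∉ xs × c List.∈ b ∷ xs
    -- If the wanted cell is already marked, any unmarked cell will do.
    reply xs c with DecMembership._∈?_ _≟ᶜ_ c xs
    ... | yes c∈xs = let b , b∉xs = fresh xs in b , b∉xs , there c∈xs
    ... | no  c∉xs = c , c∉xs , here refl

  strategy : BreakerStrategy
  strategy h m _ =
    let b₁ , b₁∉ , _ = reply (m ∷ markedCells h) (partner M m)
        b₂ , b₂∉ , _ = reply (b₁ ∷ m ∷ markedCells h) (partner N m)
    in (b₁ , b₂) , b₁∉ , b₂∉

  module _ (σ : MakerStrategy) where

    makerAt : ℕ → Pred Cell 0ℓ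
    makerAt n c = c List.∈ makerCells (play σ strategy n)

    -- The breaker sees to it that both partners of the maker's new cell are marked, and marked
    -- cells stay marked.
    edge⇒marked : ∀ n {c d} → c ∈ makerAt n → Edge c d → d List.∈ markedCells (play σ strategy n)
    edge⇒marked (suc n) (here refl) e =
      let h             = play σ strategy n
          m , _         = σ h
          b₁ , _ , M-in = reply (m ∷ markedCells h) (partner M m)
          b₂ , _ , N-in = reply (b₁ ∷ m ∷ markedCells h) (partner N m)
      in  [ (λ { refl → reorder (there M-in) }) , (λ { refl → reorder N-in }) ]′ e
      where
      reorder : ∀ {m b₁ b₂ d} {xs : List Cell} →
        d List.∈ b₂ ∷ b₁ ∷ m ∷ xs → d List.∈ m ∷ b₁ ∷ b₂ ∷ xs
      reorder (here refl)                   = there (there (here refl))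
      reorder (there (here refl))           = there (here refl)
      reorder (there (there (here refl)))   = here refl
      reorder (there (there (there d∈xs)))  = there (there (there d∈xs))
    edge⇒marked (suc n) (there c∈) e = there (there (there (edge⇒marked n c∈ e)))

    -- Of two cells joined by an edge, the one that the maker takes later is already marked at that
    -- time, so taking it would be illegal.
    maker-independent : ∀ n → Independent (makerAt n)
    maker-independent (suc n) (here refl) (here refl) e = edge-irrefl _ e
    maker-independent (suc n) (here refl) (there d∈)  e =
      proj₂ (σ (play σ strategy n)) (edge⇒marked n d∈ (edge-sym e))
    maker-independent (suc n) (there c∈)  (here refl) e =
      proj₂ (σ (play σ strategy n)) (edge⇒marked n c∈ e)
    maker-independent (suc n) (there c∈)  (there d∈)  e = maker-independent n c∈ d∈ e

  blocks⇒breaker-wins : ∀ {I : Set} (𝒮 : I → Polyomino) → (∀ i → Blocks (𝒮 i)) → ¬ MakerWins 𝒮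
  blocks⇒breaker-wins _ blocks (σ , wins) with wins strategy
  ... | n , i , g , achieved = blocks i (maker-independent σ n) (via g achieved)

  blocks⇒loser : ∀ {I J : Set} (𝒮 : I → Polyomino) → Bounded 𝒮 → (∀ i → Blocks (𝒮 i)) →
    (𝒯 : J → Polyomino) → 𝒮 ⪯ 𝒯 → Loser 𝒯
  blocks⇒loser 𝒮 _ blocks 𝒯 𝒮⪯𝒯 (inj₁ (_ , 𝒯-wins)) =
    blocks⇒breaker-wins 𝒯 (λ j independent 𝒯j≼A →
      let i , 𝒮i⊑𝒯j = 𝒮⪯𝒯 j in
      blocks i independent (≼-trans (⊑⇒≼ (𝒮 i) (𝒯 j) 𝒮i⊑𝒯j) 𝒯j≼A)) 𝒯-wins
  blocks⇒loser 𝒮 bounded blocks 𝒯 𝒮⪯𝒯 (inj₂ (_ , restrictions-win)) =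
    blocks⇒breaker-wins ℱ (λ j → blocks (proj₁ (𝒮⪯𝒯 j)))
      (restrictions-win ℱ λ j → bounded (proj₁ (𝒮⪯𝒯 j)) , proj₂ (𝒮⪯𝒯 j))
    where
    ℱ : _ → Polyomino
    ℱ j = 𝒮 (proj₁ (𝒮⪯𝒯 j))

-- Three pairs of matchings and what they block

abscissa-parity ordinate-parity diagonal-parity : Cell → Parity
abscissa-parity (x , _) = parityℤ x
ordinate-parity (_ , y) = parityℤ y
diagonal-parity (x , y) = parityℤ (x ℤ.+ y)

diagonal-translate : ∀ c d →
  diagonal-parity (translate c d) ≡ diagonal-parity c ℙ.+ diagonal-parity d
diagonal-translate (a , b) (x , y) =
  trans (cong parityℤ (interchange a x b y)) (parityℤ-+ (a ℤ.+ b) (x ℤ.+ y))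

horizontal vertical diagonal : Parity → Matching
horizontal p = record
  { axis            = 1ℤ , 0ℤ
  ; offset          = p
  ; slope           = abscissa-parity
  ; slope-translate = λ (a , _) (x , _) → parityℤ-+ a x
  ; slope-axis      = refl
  }
vertical p = record
  { axis            = 0ℤ , 1ℤ
  ; offset          = p
  ; slope           = ordinate-parity
  ; slope-translate = λ (_ , b) (_ , y) → parityℤ-+ b y
  ; slope-axis      = refl
  }
diagonal p = record
  { axis            = 1ℤ , 0ℤ
  ; offset          = p
  ; slope           = diagonal-parity
  ; slope-translate = diagonal-translate
  ; slope-axis      = refl
  }

-- The dominoes of Rows are all horizontal dominoes.  Those of Squares join the cells of 2×2 squares
-- tiling the board; in Bricks the horizontal ones are shifted by one in every other row, so that
-- every 2×2 square contains one of them.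
module Rows    = Pairing (horizontal 0ℙ) (horizontal 1ℙ)
module Bricks  = Pairing (diagonal 0ℙ) (vertical 0ℙ)
module Squares = Pairing (horizontal 0ℙ) (vertical 0ℙ)

-- The two matchings have opposite offsets, so every cell is initial in one of them.
rows-edge : ∀ t d → Rows.Edge (translate t d) (translate t (translate d (1ℤ , 0ℤ)))
rows-edge t d rewrite translate-translate t d (1ℤ , 0ℤ) with abscissa-parity (translate t d)
... | 0ℙ = inj₁ refl
... | 1ℙ = inj₂ refl

-- One arm of every copy of `L₂` is horizontal. The edge is taken from its left cell, which is
-- (-1,0) when the arm points to the left.
rows-block-L₂ : Rows.Blocks L₂
rows-block-L₂ {A} independent (via g L₂→A) =
  blocked g (L₂→A (here refl)) (L₂→A (there (here refl))) (L₂→A (there (there (here refl))))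
  where
  blocked : ∀ g → g · origin ∈ A → g · (1ℤ , 0ℤ) ∈ A → g · (0ℤ , 1ℤ) ∈ A → ⊥
  blocked ⟨ false , 0F , t ⟩ p q r = independent p q (rows-edge t origin)
  blocked ⟨ false , 1F , t ⟩ p q r = independent r p (rows-edge t (-1ℤ , 0ℤ))
  blocked ⟨ false , 2F , t ⟩ p q r = independent q p (rows-edge t (-1ℤ , 0ℤ))
  blocked ⟨ false , 3F , t ⟩ p q r = independent p r (rows-edge t origin)
  blocked ⟨ true  , 0F , t ⟩ p q r = independent p q (rows-edge t origin)
  blocked ⟨ true  , 1F , t ⟩ p q r = independent p r (rows-edge t origin)
  blocked ⟨ true  , 2F , t ⟩ p q r = independent q p (rows-edge t (-1ℤ , 0ℤ))
  blocked ⟨ true  , 3F , t ⟩ p q r = independent r p (rows-edge t (-1ℤ , 0ℤ))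

module _ {M N : Matching}
         (M-horizontal : axis M ≡ (1ℤ , 0ℤ)) (N-vertical : axis N ≡ (0ℤ , 1ℤ)) where

  open Pairing M N

  -- Successive cells along an axis alternate in colour, so one of the two dominoes in a row of
  -- three cells belongs to the matching in its direction.
  pairing-blocks-S₃ : Blocks (S 3)
  pairing-blocks-S₃ {A} independent (via g S₃→A) = blocked g
    (S₃→A (0 , s≤s z≤n , refl))
    (S₃→A (1 , s≤s (s≤s z≤n) , refl))
    (S₃→A (2 , s≤s (s≤s (s≤s z≤n)) , refl))
    where
    blocked : ∀ g → g · origin ∈ A → g · (1ℤ , 0ℤ) ∈ A → g · (+ 2 , 0ℤ) ∈ A → ⊥
    blocked ⟨ false , 0F , t ⟩ p q r =
      [ independent p q , independent q r ]′ (consecutive₁ M-horizontal t origin)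
    blocked ⟨ false , 1F , t ⟩ p q r =
      [ independent p q , independent q r ]′ (consecutive₂ N-vertical t origin)
    blocked ⟨ false , 2F , t ⟩ p q r =
      [ independent r q , independent q p ]′ (consecutive₁ M-horizontal t (-[1+ 1 ] , 0ℤ))
    blocked ⟨ false , 3F , t ⟩ p q r =
      [ independent r q , independent q p ]′ (consecutive₂ N-vertical t (0ℤ , -[1+ 1 ]))
    -- The reflection fixes each cell of `S 3`.
    blocked ⟨ true  , 0F , t ⟩ = blocked ⟨ false , 0F , t ⟩
    blocked ⟨ true  , 1F , t ⟩ = blocked ⟨ false , 1F , t ⟩
    blocked ⟨ true  , 2F , t ⟩ = blocked ⟨ false , 2F , t ⟩
    blocked ⟨ true  , 3F , t ⟩ = blocked ⟨ false , 3F , t ⟩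

-- The left cells of the two rows of the square differ in diagonal parity, so one of these rows is a
-- domino of the first matching.
bricks-block-C₂ : Bricks.Blocks C₂
bricks-block-C₂ {A} independent (via g C₂→A) = blocked g
  (C₂→A (here refl)) (C₂→A (there (here refl)))
  (C₂→A (there (there (here refl)))) (C₂→A (there (there (there (here refl)))))
  where
  blocked : ∀ g → g · origin ∈ A → g · (1ℤ , 0ℤ) ∈ A → g · (0ℤ , 1ℤ) ∈ A → g · (1ℤ , 1ℤ) ∈ A → ⊥
  blocked ⟨ false , 0F , t ⟩ p q r s =
    [ independent p q , independent r s ]′ (Bricks.matched₁ t origin (0ℤ , 1ℤ) refl)
  blocked ⟨ false , 1F , t ⟩ p q r s =
    [ independent r p , independent s q ]′ (Bricks.matched₁ t (-1ℤ , 0ℤ) (-1ℤ , 1ℤ) refl)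
  blocked ⟨ false , 2F , t ⟩ p q r s =
    [ independent q p , independent s r ]′ (Bricks.matched₁ t (-1ℤ , 0ℤ) (-1ℤ , -1ℤ) refl)
  blocked ⟨ false , 3F , t ⟩ p q r s =
    [ independent p r , independent q s ]′ (Bricks.matched₁ t origin (0ℤ , -1ℤ) refl)
  blocked ⟨ true  , 0F , t ⟩ p q r s =
    [ independent p q , independent r s ]′ (Bricks.matched₁ t origin (0ℤ , -1ℤ) refl)
  blocked ⟨ true  , 1F , t ⟩ p q r s =
    [ independent p r , independent q s ]′ (Bricks.matched₁ t origin (0ℤ , 1ℤ) refl)
  blocked ⟨ true  , 2F , t ⟩ p q r s =
    [ independent q p , independent s r ]′ (Bricks.matched₁ t (-1ℤ , 0ℤ) (-1ℤ , 1ℤ) refl)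
  blocked ⟨ true  , 3F , t ⟩ p q r s =
    [ independent r p , independent s q ]′ (Bricks.matched₁ t (-1ℤ , 0ℤ) (-1ℤ , -1ℤ) refl)

-- A copy of `Z₂` consists of two parallel dominoes shifted by one along their own direction. Their
-- initial ends have opposite slopes, so one of them belongs to the vertical matching or, after an
-- odd turn, to the horizontal one.
squares-block-Z₂ : Squares.Blocks Z₂
squares-block-Z₂ {A} independent (via g Z₂→A) = blocked g
  (Z₂→A (here refl)) (Z₂→A (there (here refl)))
  (Z₂→A (there (there (here refl)))) (Z₂→A (there (there (there (here refl)))))
  where
  blocked : ∀ g → g · origin ∈ A → g · (1ℤ , 0ℤ) ∈ A → g · (0ℤ , 1ℤ) ∈ A → g · (1ℤ , -1ℤ) ∈ A → ⊥
  blocked ⟨ false , 0F , t ⟩ p q r s =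
    [ independent p r , independent s q ]′ (Squares.matched₂ t origin (1ℤ , -1ℤ) refl)
  blocked ⟨ false , 1F , t ⟩ p q r s =
    [ independent r p , independent q s ]′ (Squares.matched₁ t (-1ℤ , 0ℤ) (0ℤ , 1ℤ) refl)
  blocked ⟨ false , 2F , t ⟩ p q r s =
    [ independent r p , independent q s ]′ (Squares.matched₂ t (0ℤ , -1ℤ) (-1ℤ , 0ℤ) refl)
  blocked ⟨ false , 3F , t ⟩ p q r s =
    [ independent p r , independent s q ]′ (Squares.matched₁ t origin (-1ℤ , -1ℤ) refl)
  blocked ⟨ true  , 0F , t ⟩ p q r s =
    [ independent r p , independent q s ]′ (Squares.matched₂ t (0ℤ , -1ℤ) (1ℤ , 0ℤ) refl)
  blocked ⟨ true  , 1F , t ⟩ p q r s =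
    [ independent p r , independent s q ]′ (Squares.matched₁ t origin (-1ℤ , 1ℤ) refl)
  blocked ⟨ true  , 2F , t ⟩ p q r s =
    [ independent p r , independent s q ]′ (Squares.matched₂ t origin (-1ℤ , -1ℤ) refl)
  blocked ⟨ true  , 3F , t ⟩ p q r s =
    [ independent r p , independent q s ]′ (Squares.matched₁ t (-1ℤ , 0ℤ) (0ℤ , -1ℤ) refl)

-- The product of the two coordinate distances is invariant under congruences.
L₂⋠Line : ¬ cells L₂ ≼ cells Line
L₂⋠Line (via g L₂→Line) = contradiction
  (trans (sym (isometry ℕ.*-comm g (1ℤ , 0ℤ) (0ℤ , 1ℤ)))
    (on-line (L₂→Line (there (here refl))) (L₂→Line (there (there (here refl))))))
  λ ()
  where
  on-line : ∀ {c d} → c ∈ cells Line → d ∈ cells Line → distance ℕ._*_ c d ≡ 0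
  on-line (x , refl) (x′ , refl) = ℕ.*-zeroʳ ∣ x ℤ.- x′ ∣

-- Another invariant: the two coordinate distances differ by 2 between the ends of S 3.
NoS₃Ends : List Cell → Set
NoS₃Ends xs = All (λ c → All (λ d → distance ℕ.∣_-_∣ c d ≢ 2) xs) xs

noS₃Ends? : ∀ xs → Dec (NoS₃Ends xs)
noS₃Ends? xs = All.all? (λ c → All.all? (λ d → ¬? (distance ℕ.∣_-_∣ c d ℕ.≟ 2)) xs) xs

S₃⋠ : ∀ {xs} → NoS₃Ends xs → ¬ cells (S 3) ≼ (List._∈ xs)
S₃⋠ noEnds (via g S₃→xs) =
  All.lookup (All.lookup noEnds (S₃→xs (0 , s≤s z≤n , refl)))
    (S₃→xs (2 , s≤s (s≤s (s≤s z≤n)) , refl))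
    (isometry ℕ.∣-∣-comm g origin (+ 2 , 0ℤ))

S₃⋠L₂ : ¬ cells (S 3) ≼ cells L₂
S₃⋠L₂ = S₃⋠ (from-yes (noS₃Ends? ((0ℤ , 0ℤ) ∷ (1ℤ , 0ℤ) ∷ (0ℤ , 1ℤ) ∷ [])))

S₃⋠C₂ : ¬ cells (S 3) ≼ cells C₂
S₃⋠C₂ = S₃⋠ (from-yes (noS₃Ends? ((0ℤ , 0ℤ) ∷ (1ℤ , 0ℤ) ∷ (0ℤ , 1ℤ) ∷ (1ℤ , 1ℤ) ∷ [])))

S₃⋠Z₂ : ¬ cells (S 3) ≼ cells Z₂
S₃⋠Z₂ = S₃⋠ (from-yes (noS₃Ends? ((0ℤ , 0ℤ) ∷ (1ℤ , 0ℤ) ∷ (0ℤ , 1ℤ) ∷ (1ℤ , -1ℤ) ∷ [])))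

-- The maker builds a bend or an arbitrarily long row

unique-lookup : ∀ {xs : List Cell} → Unique xs → ∀ {i j} → i Fin.< j → lookup xs i ≢ lookup xs j
unique-lookup (x≢ ∷ _)   {0F}        {Fin.suc j} _         = All.lookup x≢ (List.∈-lookup j)
unique-lookup (_ ∷ uniq) {Fin.suc i} {Fin.suc j} (s≤s i<j) = unique-lookup uniq i<j

-- If `ys` were shorter, two indices of `xs` would share a position in `ys` by the pigeonhole
-- principle.
unique-length : ∀ {xs ys : List Cell} → Unique xs → All (List._∈ ys) xs → length xs ℕ.≤ length ys
unique-length {xs} {ys} uniq xs⊆ys = ℕ.≮⇒≥ λ ys<xs →
  let i , j , i<j , eq = Fin.pigeonhole ys<xs (index ∘ position)
  in unique-lookup uniq i<j (index-injective (setoid Cell) (position i) (position j) eq)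
  where
  position : ∀ i → lookup xs i List.∈ ys
  position i = All.lookup xs⊆ys (List.∈-lookup i)

length-marked : ∀ h → length (markedCells h) ≡ 3 ℕ.* length h
length-marked []      = refl
length-marked (_ ∷ h) = trans (cong (3 ℕ.+_) (length-marked h)) (sym (ℕ.*-suc 3 (length h)))

maker⊆marked : ∀ h {c} → c List.∈ makerCells h → c List.∈ markedCells h
maker⊆marked (_ ∷ h) (here refl) = here refl
maker⊆marked (_ ∷ h) (there c∈)  = there (there (there (maker⊆marked h c∈)))

-- A row of `n` cells with the cells on both sides of it: exactly as many cells as `n` rounds mark.
band : ℕ → List Cell
band zero    = []
band (suc n) = (+ n , 0ℤ) ∷ (+ n , 1ℤ) ∷ (+ n , -1ℤ) ∷ band n

length-band : ∀ n → length (band n) ≡ 3 ℕ.* n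
length-band zero    = refl
length-band (suc n) = trans (cong (3 ℕ.+_) (length-band n)) (sym (ℕ.*-suc 3 n))

band-left : ∀ n {m y} → n ℕ.≤ m → All ((+ m , y) ≢_) (band n)
band-left zero    _   = []
band-left (suc n) n<m = differ n<m ∷ differ n<m ∷ differ n<m ∷ band-left n (ℕ.<⇒≤ n<m)
  where
  differ : ∀ {m n y y′} → n ℕ.< m → _≢_ {A = Cell} (+ m , y) (+ n , y′)
  differ n<m refl = ℕ.<-irrefl refl n<m

band-unique : ∀ n → Unique (band n)
band-unique zero    = []
band-unique (suc n) =
  ((λ ()) ∷ (λ ()) ∷ band-left n ℕ.≤-refl) ∷
  ((λ ()) ∷ band-left n ℕ.≤-refl) ∷
  band-left n ℕ.≤-refl ∷
  band-unique n

rotation : Fin 4 → Congruence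
rotation k = ⟨ false , k , origin ⟩

-- The strategy of the maker

module Maker (em : ExcludedMiddle 0ℓ) where

  OnRow : History → Fin 4 → ℕ → Set
  OnRow h k n = ∀ {i} → i ℕ.< n → rotation k · (+ i , 0ℤ) List.∈ makerCells h

  Bend : History → Cell → Set
  Bend h m = cells L₂ ≼ (List._∈ m ∷ makerCells h)

  Bendable Extendable : History → Set
  Bendable   h = ∃[ m ] m List.∉ markedCells h × Bend h m
  Extendable h = ∃[ k ] OnRow h k (length h) × rotation k · (+ length h , 0ℤ) List.∉ markedCells h

  strategy : MakerStrategy
  strategy h with em {Bendable h} | em {Extendable h}
  ... | yes (m , free , _) | _                  = m , free
  ... | no _               | yes (k , _ , free) = _ , free
  -- A default for histories that the strategy itself never produces before a bend:
  -- `bendable-or-extendable` excludes this case while all moves form a row.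
  ... | no _               | no _               = fresh (markedCells h)

  -- The direction `k` is the one that the strategy finds, which need not be that of the row known
  -- so far.
  strategy-bends-or-extends : ∀ h → Bendable h ⊎ Extendable h →
    Bend h (proj₁ (strategy h)) ⊎
    ∃[ k ] OnRow h k (length h) × rotation k · (+ length h , 0ℤ) ≡ proj₁ (strategy h)
  strategy-bends-or-extends h possible with em {Bendable h} | em {Extendable h}
  ... | yes (_ , _ , bend) | _                 = inj₁ bend
  ... | no _               | yes (k , row , _) = inj₂ (k , row , refl)
  ... | no ¬bend           | no ¬extend        = contradiction possible [ ¬bend , ¬extend ]′

  -- With at least two cells in the row, the cell of abscissa `i` has a neighbour in it: the right
  -- one for `i` zero, the left one otherwise. This neighbour is the second arm of the bend.
  bend-row : ∀ h k n → OnRow h k (2 ℕ.+ n) → ∀ {i} → i ℕ.< 2 ℕ.+ n →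
    Bend h (rotation k · (+ i , 1ℤ)) × Bend h (rotation k · (+ i , -1ℤ))
  bend-row h k n row {i} i<n =
    ≼-trans (proj₁ (bends i i<n)) turned , ≼-trans (proj₂ (bends i i<n)) turned
    where
    After : Cell → Pred Cell 0ℓ
    After c d = rotation k · d List.∈ rotation k · c ∷ makerCells h

    turned : ∀ {c} → After c ≼ (List._∈ rotation k · c ∷ makerCells h)
    turned = via (rotation k) id

    last : ∀ j y → (+ (j ℕ.+ 0) , y) ∈ After (+ j , y)
    last j y = here (cong (λ j → rotation k · (+ j , y)) (ℕ.+-identityʳ j))

    bends : ∀ i → i ℕ.< 2 ℕ.+ n → cells L₂ ≼ After (+ i , 1ℤ) × cells L₂ ≼ After (+ i , -1ℤ)
    bends zero    i<n =
      corner 0F (there (row i<n)) right (last 0 1ℤ) ,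
      corner 3F (there (row i<n)) (last 0 -1ℤ) right
      where
      right : ∀ {c} → (1ℤ , 0ℤ) ∈ After c
      right = there (row (s≤s (s≤s z≤n)))
    bends (suc i) i<n =
      corner 1F (there (row i<n)) (last (suc i) 1ℤ) left ,
      corner 2F (there (row i<n)) left (last (suc i) -1ℤ)
      where
      left : ∀ {c} → (+ i , 0ℤ) ∈ After c
      left = there (row (ℕ.<⇒≤ i<n))

  -- By counting against the cells marked so far. One round marks three cells, too few for the four
  -- neighbours of the origin. After `n` rounds, with `n` at least 2 and no bend available, the
  -- whole band is marked; its 3n cells leave no room for the next cell of the row.
  bendable-or-extendable : ∀ h k → OnRow h k (length h) → Bendable h ⊎ Extendable h
  bendable-or-extendable [] k row = inj₂ (k , row , λ ())
  bendable-or-extendable h@(_ ∷ []) k row = inj₂ (decidable-stable em λ ¬extend →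
    contradiction
      (unique-length (from-yes (DecUnique.unique? _≟ᶜ_ units))
        (All.map⁺ (All.universal (neighbour ¬extend) (allFin 4))))
      λ { (s≤s (s≤s (s≤s ()))) })
    where
    units = map unit (allFin 4)

    fixed : ∀ l → rotation l · origin ≡ rotation k · origin
    fixed l = trans (·-origin false l origin) (sym (·-origin false k origin))

    on-row : ∀ l → OnRow h l 1
    on-row l (s≤s z≤n) = subst (List._∈ makerCells h) (sym (fixed l)) (row (s≤s z≤n))

    neighbour : ¬ Extendable h → ∀ l → unit l List.∈ markedCells h
    neighbour ¬extend l = decidable-stable em λ free →
      ¬extend (l , on-row l , free ∘ subst (List._∈ markedCells h) (identity· (unit l)))
  bendable-or-extendable h@(_ ∷ _ ∷ h′) k row with em {Bendable h}
  ... | yes bend = inj₁ bend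
  ... | no ¬bend = inj₂ (k , row , λ end-marked → ℕ.<-irrefl refl (begin-strict
    3 ℕ.* n                 ≡⟨ length-band n ⟨
    length (band n)         <⟨ ℕ.n<1+n _ ⟩
    length band⁺            ≡⟨ List.length-map (rotation k ·_) band⁺ ⟨
    length (map (rotation k ·_) band⁺)
      ≤⟨ unique-length
           (Unique.map⁺ (·-injective (rotation k)) (band-left n ℕ.≤-refl ∷ band-unique n))
           (end-marked ∷ All.map⁺ (band-marked n ℕ.≤-refl)) ⟩
    length (markedCells h)  ≡⟨ length-marked h ⟩
    3 ℕ.* n                 ∎))
    where
    open ℕ.≤-Reasoning
    n = length h
    band⁺ = (+ n , 0ℤ) ∷ band n

    side-marked : ∀ {c} → Bend h (rotation k · c) → rotation k · c List.∈ markedCells h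
    side-marked bend = decidable-stable em λ free → ¬bend (_ , free , bend)

    band-marked : ∀ i → i ℕ.≤ n → All (λ c → rotation k · c List.∈ markedCells h) (band i)
    band-marked zero    _   = []
    band-marked (suc i) i<n =
      let above , below = bend-row h k (length h′) row i<n in
      maker⊆marked h (row i<n) ∷ side-marked above ∷ side-marked below ∷ band-marked i (ℕ.<⇒≤ i<n)

  module _ (τ : BreakerStrategy) where

    length-play : ∀ n → length (play strategy τ n) ≡ n
    length-play zero    = refl
    length-play (suc n) = cong suc (length-play n)

    -- The row keeps pace with the number of rounds, as the counting in `bendable-or-extendable`
    -- demands.
    bend-or-row : ∀ n → (∃[ m ] cells L₂ ≼ (List._∈ makerCells (play strategy τ m))) ⊎
                        (∃[ k ] OnRow (play strategy τ n) k n)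
    bend-or-row zero = inj₂ (0F , λ ())
    bend-or-row (suc n) with bend-or-row n
    ... | inj₁ bend      = inj₁ bend
    ... | inj₂ (k , row) = next (strategy-bends-or-extends h
      (bendable-or-extendable h k (subst (OnRow h k) (sym (length-play n)) row)))
      where
      h = play strategy τ n

      next : Bend h (proj₁ (strategy h)) ⊎
             ∃[ k ] OnRow h k (length h) × rotation k · (+ length h , 0ℤ) ≡ proj₁ (strategy h) → _
      next (inj₁ bend)            = inj₁ (suc n , bend)
      next (inj₂ (l , row , end)) = inj₂ (l , λ { (s≤s i≤n) → extend (ℕ.m≤n⇒m<n∨m≡n i≤n) })
        where
        extend : ∀ {i} → i ℕ.< n ⊎ i ≡ n →
          rotation l · (+ i , 0ℤ) List.∈ makerCells (play strategy τ (suc n))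
        extend (inj₁ i<n)  = there (row (subst (_ ℕ.<_) (sym (length-play n)) i<n))
        extend (inj₂ refl) =
          here (subst (λ m → rotation l · (+ m , 0ℤ) ≡ proj₁ (strategy h)) (length-play n) end)

  -- A bend contains a copy of `𝒢 j`. A long enough row contains one of `𝒢 i`, which is finite and
  -- fits into the ray.
  simpler⇒maker-wins : ∀ {I : Set} (𝒢 : I → Polyomino) → Bounded 𝒢 → 𝒢 ⪯ 𝒴₂ → MakerWins 𝒢
  simpler⇒maker-wins 𝒢 bounded 𝒢⪯𝒴₂ with 𝒢⪯𝒴₂ 0F | 𝒢⪯𝒴₂ 1F
  ... | i , g , 𝒢i→S∞ | j , 𝒢j⊑L₂ = strategy , λ τ → achieve τ (bend-or-row τ n)
    where
    xs = proj₁ (bounded i)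
    -- The copy of `𝒢 i` in the ray lies among the first `n` cells, so `n` rounds suffice unless a
    -- bend occurs.
    n  = proj₁ (abscissae-bounded (map (g ·_) xs))

    short : ∀ {c} → c ∈ cells (𝒢 i) → ∃[ m ] m ℕ.< n × g · c ≡ (+ m , 0ℤ)
    short c∈
      with 𝒢i→S∞ c∈
         | proj₂ (abscissae-bounded (map (g ·_) xs)) (List.∈-map⁺ (g ·_) (proj₂ (bounded i) c∈))
    ... | m , eq | m<n = m , subst (λ d → ∣ proj₁ d ∣ ℕ.< n) eq m<n , eq

    row≼ : ∀ {h k} → OnRow h k n → cells (𝒢 i) ≼ (List._∈ makerCells h)
    row≼ {h} {k} row = ≼-trans
      {B = λ d → ∃[ m ] m ℕ.< n × d ≡ (+ m , 0ℤ)} (via g short)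
      (via (rotation k) λ { (_ , m<n , refl) → row m<n })

    achieve : ∀ τ →
      (∃[ m ] cells L₂ ≼ (List._∈ makerCells (play strategy τ m))) ⊎
      (∃[ k ] OnRow (play strategy τ n) k n) →
      ∃[ m ] Achieved 𝒢 (play strategy τ m)
    achieve τ (inj₁ (m , L₂≼)) =
      let via f fits = ≼-trans (⊑⇒≼ (𝒢 j) L₂ 𝒢j⊑L₂) L₂≼ in m , j , f , fits
    achieve τ (inj₂ (k , row)) =
      let via f fits = row≼ {play strategy τ n} {k} row in n , i , f , fits

  -- Each bounded restriction of `𝒢` is again simpler than `𝒴₂`, so the bounded case applies to it.
  simpler⇒winner : ∀ {I : Set} (𝒢 : I → Polyomino) → 𝒢 ⪯ 𝒴₂ → Winner 𝒢
  simpler⇒winner 𝒢 𝒢⪯𝒴₂ with em {Unbounded 𝒢}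
  ... | no ¬unbounded = inj₁ (bounded , simpler⇒maker-wins 𝒢 bounded 𝒢⪯𝒴₂)
    where
    bounded : Bounded 𝒢
    bounded i = decidable-stable em λ infinite → ¬unbounded (i , infinite)
  ... | yes unbounded = inj₂ (unbounded , λ ℱ restriction →
    simpler⇒maker-wins ℱ (proj₁ ∘ restriction) λ j →
      let i , 𝒢i⊑ = 𝒢⪯𝒴₂ j in
      i , ≼⇒⊑ (ℱ i) (𝒴₂ j)
        (≼-trans (⊑⇒≼ (ℱ i) (𝒢 i) (proj₂ (restriction i))) (⊑⇒≼ (𝒢 i) (𝒴₂ j) 𝒢i⊑)))

-- The dichotomy

S∞⋠L₂ : ¬ cells S∞ ≼ cells L₂
S∞⋠L₂ = S₃⋠L₂ ∘ ≼-trans (⊆⇒≼ λ { (i , _ , eq) → i , eq })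

𝒴₂-team : Team 𝒴₂
𝒴₂-team {0F} {0F} i≢j _     = i≢j refl
𝒴₂-team {0F} {1F} _   S∞⊑L₂ = S∞⋠L₂ (⊑⇒≼ S∞ L₂ S∞⊑L₂)
𝒴₂-team {1F} {0F} _   L₂⊑S∞ =
  L₂⋠Line (≼-trans (⊑⇒≼ L₂ S∞ L₂⊑S∞) (⊆⇒≼ λ { (i , eq) → + i , eq }))
𝒴₂-team {1F} {1F} i≢j _     = i≢j refl

𝒩₂₁-team : Team 𝒩₂₁
𝒩₂₁-team {0F} {0F} i≢j _ = i≢j refl

-- A polyomino with a bend does not fit into `S 3`, which is part of the line.
S₃-team : ∀ Q → ¬ cells (S 3) ≼ cells Q → cells L₂ ≼ cells Q →
  Team (S 3 Vector.∷ Q Vector.∷ Vector.[])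
S₃-team Q _     _    {0F} {0F} i≢j _    = i≢j refl
S₃-team Q S₃⋠Q  _    {0F} {1F} _   S₃⊑Q = S₃⋠Q (⊑⇒≼ (S 3) Q S₃⊑Q)
S₃-team Q _     L₂≼Q {1F} {0F} _   Q⊑S₃ =
  L₂⋠Line (≼-trans L₂≼Q (≼-trans (⊑⇒≼ Q (S 3) Q⊑S₃) (⊆⇒≼ λ { (i , _ , eq) → + i , eq })))
S₃-team Q _     _    {1F} {1F} i≢j _    = i≢j refl

L₂≼C₂ : cells L₂ ≼ cells C₂
L₂≼C₂ = L₂≼ identity (here refl) (there (here refl)) (there (there (here refl)))

L₂≼Z₂ : cells L₂ ≼ cells Z₂
L₂≼Z₂ = L₂≼ identity (here refl) (there (here refl)) (there (there (here refl)))

S₃-finite : Finite (S 3)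
S₃-finite = origin ∷ (1ℤ , 0ℤ) ∷ (+ 2 , 0ℤ) ∷ [] , λ
  { (0 , _ , refl) → here refl
  ; (1 , _ , refl) → there (here refl)
  ; (2 , _ , refl) → there (there (here refl))
  ; (suc (suc (suc _)) , s≤s (s≤s (s≤s ())) , _)
  }

-- The three losing sets

𝒩₂₁-loses : ∀ {I : Set} (𝒯 : I → Polyomino) → 𝒩₂₁ ⪯ 𝒯 → Loser 𝒯
𝒩₂₁-loses = Rows.blocks⇒loser 𝒩₂₁ (λ { 0F → _ , id }) (λ { 0F {A} → rows-block-L₂ {A} })

𝒩₂₂-loses : ∀ {I : Set} (𝒯 : I → Polyomino) → 𝒩₂₂ ⪯ 𝒯 → Loser 𝒯
𝒩₂₂-loses = Bricks.blocks⇒loser 𝒩₂₂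
  (λ { 0F → S₃-finite ; 1F → _ , id })
  (λ { 0F {A} → pairing-blocks-S₃ refl refl {A} ; 1F {A} → bricks-block-C₂ {A} })

𝒩₂₃-loses : ∀ {I : Set} (𝒯 : I → Polyomino) → 𝒩₂₃ ⪯ 𝒯 → Loser 𝒯
𝒩₂₃-loses = Squares.blocks⇒loser 𝒩₂₃
  (λ { 0F → S₃-finite ; 1F → _ , id })
  (λ { 0F {A} → pairing-blocks-S₃ refl refl {A} ; 1F {A} → squares-block-Z₂ {A} })

⪯-refl : ∀ {I : Set} (𝒮 : I → Polyomino) → 𝒮 ⪯ 𝒮
⪯-refl 𝒮 i = i , ≼⇒⊑ (𝒮 i) (𝒮 i) (⊆⇒≼ id)

-- Teams of size 2

Dichotomy : Vector Polyomino 2 → Set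
Dichotomy 𝓕 = 𝓕 ⪯ 𝒴₂ ⊎ (𝒩₂₁ ⪯ 𝓕 ⊎ 𝒩₂₂ ⪯ 𝓕 ⊎ 𝒩₂₃ ⪯ 𝓕)

module _ (em : ExcludedMiddle 0ℓ) where

  open Classical em

  -- The indices are arbitrary, with `covers`, so that either member may be the straight one. A
  -- straight member without `S 3` would fit into `L₂` and thus into the bent member.
  straight-bent-dichotomy : ∀ 𝓕 → Team 𝓕 → ¬ IsLineAndL₂ 𝓕 →
    ∀ {i j} → i ≢ j → (∀ l → l ≡ i ⊎ l ≡ j) →
    Straight (cells (𝓕 i)) → cells L₂ ≼ cells (𝓕 j) → Dichotomy 𝓕
  straight-bent-dichotomy 𝓕 team ¬LineL₂ {i} {j} i≢j covers i-straight L₂≼j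
    with S₃≼straight⊎straight≼L₂ i-straight
  ... | inj₂ i≼L₂ = contradiction (≼⇒⊑ (𝓕 i) (𝓕 j) (≼-trans i≼L₂ L₂≼j)) (team i≢j)
  ... | inj₁ S₃≼i with bent (𝓕 j) L₂≼j
  ...   | inj₁ S₃≼j = inj₂ (inj₂ (inj₁ λ l → 0F , ≼⇒⊑ (S 3) (𝓕 l) (S₃≼𝓕 l (covers l))))
    where
    S₃≼𝓕 : ∀ l → l ≡ i ⊎ l ≡ j → cells (S 3) ≼ cells (𝓕 l)
    S₃≼𝓕 _ (inj₁ refl) = S₃≼i
    S₃≼𝓕 _ (inj₂ refl) = S₃≼j
  ...   | inj₂ (inj₁ C₂≼j) = inj₂ (inj₂ (inj₁ λ l → ancestor l (covers l)))
    where
    ancestor : ∀ l → l ≡ i ⊎ l ≡ j → ∃[ k ] 𝒩₂₂ k ⊑ 𝓕 l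
    ancestor _ (inj₁ refl) = 0F , ≼⇒⊑ (S 3) (𝓕 i) S₃≼i
    ancestor _ (inj₂ refl) = 1F , ≼⇒⊑ C₂ (𝓕 j) C₂≼j
  ...   | inj₂ (inj₂ (inj₁ Z₂≼j)) = inj₂ (inj₂ (inj₂ λ l → ancestor l (covers l)))
    where
    ancestor : ∀ l → l ≡ i ⊎ l ≡ j → ∃[ k ] 𝒩₂₃ k ⊑ 𝓕 l
    ancestor _ (inj₁ refl) = 0F , ≼⇒⊑ (S 3) (𝓕 i) S₃≼i
    ancestor _ (inj₂ refl) = 1F , ≼⇒⊑ Z₂ (𝓕 j) Z₂≼j
  ...   | inj₂ (inj₂ (inj₂ j≈L₂)) with i-straight
  ...     | inj₁ (via g i⇔Line) = contradiction ((i , g , i⇔Line) , (j , ≈⇒≅ (𝓕 j) L₂ j≈L₂)) ¬LineL₂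
  -- The straight member is an initial segment of the ray and the bent one is `L₂` itself, so the
  -- team is simpler than `𝒴₂`.
  ...     | inj₂ (X , _ , i≈X)  = inj₁ λ
    { 0F → i , ≼⇒⊑ (𝓕 i) S∞ (≼-trans (≈⇒≼ i≈X) (⊆⇒≼ λ { (m , _ , eq) → m , eq }))
    ; 1F → j , ≼⇒⊑ (𝓕 j) L₂ (≈⇒≼ j≈L₂)
    }

  dichotomy : ∀ 𝓕 → Team 𝓕 → ¬ IsLineAndL₂ 𝓕 → Dichotomy 𝓕
  dichotomy 𝓕 team ¬LineL₂ with em {cells L₂ ≼ cells (𝓕 0F)} | em {cells L₂ ≼ cells (𝓕 1F)}
  ... | yes L₂≼0 | yes L₂≼1 = inj₂ (inj₁ λ
    { 0F → 0F , ≼⇒⊑ L₂ (𝓕 0F) L₂≼0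
    ; 1F → 0F , ≼⇒⊑ L₂ (𝓕 1F) L₂≼1
    })
  ... | no L₂⋠0 | yes L₂≼1 =
    straight-bent-dichotomy 𝓕 team ¬LineL₂ (λ ()) (λ { 0F → inj₁ refl ; 1F → inj₂ refl })
      (unbent⇒straight (𝓕 0F) L₂⋠0) L₂≼1
  ... | yes L₂≼0 | no L₂⋠1 =
    straight-bent-dichotomy 𝓕 team ¬LineL₂ (λ ()) (λ { 0F → inj₂ refl ; 1F → inj₁ refl })
      (unbent⇒straight (𝓕 1F) L₂⋠1) L₂≼0
  ... | no L₂⋠0 | no L₂⋠1
    with straight-comparable (unbent⇒straight (𝓕 0F) L₂⋠0) (unbent⇒straight (𝓕 1F) L₂⋠1)
  ...   | inj₁ 0≼1 = contradiction (≼⇒⊑ (𝓕 0F) (𝓕 1F) 0≼1) (team λ ())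
  ...   | inj₂ 1≼0 = contradiction (≼⇒⊑ (𝓕 1F) (𝓕 0F) 1≼0) (team λ ())

proposition6p2 :
  ExcludedMiddle 0ℓ →
    (Team 𝒴₂ × Winner 𝒴₂)
  × (Team 𝒩₂₁ × Loser 𝒩₂₁)
  × (Team 𝒩₂₂ × Loser 𝒩₂₂)
  × (Team 𝒩₂₃ × Loser 𝒩₂₃)
  × ((𝓕 : Vector Polyomino 2) → Team 𝓕 → ¬ IsLineAndL₂ 𝓕 →
      𝓕 ⪯ 𝒴₂ ⊎ (𝒩₂₁ ⪯ 𝓕 ⊎ 𝒩₂₂ ⪯ 𝓕 ⊎ 𝒩₂₃ ⪯ 𝓕))
  × ((𝓕 : Vector Polyomino 2) → Team 𝓕 → ¬ IsLineAndL₂ 𝓕 →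
      Winner 𝓕 ⇔ 𝓕 ⪯ 𝒴₂)
proposition6p2 em =
    (𝒴₂-team , simpler⇒winner 𝒴₂ (⪯-refl 𝒴₂))
  , (𝒩₂₁-team , 𝒩₂₁-loses 𝒩₂₁ (⪯-refl 𝒩₂₁))
  , (S₃-team C₂ S₃⋠C₂ L₂≼C₂ , 𝒩₂₂-loses 𝒩₂₂ (⪯-refl 𝒩₂₂))
  , (S₃-team Z₂ S₃⋠Z₂ L₂≼Z₂ , 𝒩₂₃-loses 𝒩₂₃ (⪯-refl 𝒩₂₃))
  , dichotomy em
  , λ 𝓕 team ¬LineL₂ → mk⇔
      (λ winner → [ id
                  , [ (λ loses → contradiction winner (𝒩₂₁-loses 𝓕 loses))
                    , [ (λ loses → contradiction winner (𝒩₂₂-loses 𝓕 loses))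
                      , (λ loses → contradiction winner (𝒩₂₃-loses 𝓕 loses)) ]′ ]′ ]′
                  (dichotomy em 𝓕 team ¬LineL₂))
      (simpler⇒winner 𝓕)
  where open Maker em using (simpler⇒winner)
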